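{- Let $\mathcal{P}$ be a $d$-dimensional integral polytope with Ehrhart polynomial $i(\mathcal{P},t)=1+\sum_{i=1}^{d}c_it^i$, where each $c_i\neq0$. Then there exists a $(d+3)$-dimensional integral polytope $\mathcal{Q}$ with Ehrhart polynomial $i(\mathcal{Q},t)=1+\sum_{i=1}^{d+3}h_it^i$ such that $\mathrm{sgn}(h_i)=\mathrm{sgn}(c_{i-3})$ for all $4\le i\le d+1$, $\mathrm{sgn}(h_3)=+1$, $\mathrm{sgn}(h_2)=-\mathrm{sgn}(c_1)$, and $\mathrm{sgn}(h_1)=-1$.
   Context: An integral polytope is a convex polytope all of whose vertices have integer coordinates. For an integral polytope $\mathcal{P}\subseteq\mathbb{R}^N$ of dimension $d$, $i(\mathcal{P},t)=|t\mathcal{P}\cap\mathbb{Z}^N|$ ($t$ a positive integer) is a polynomial in $t$ of degree $d$ with constant term $1$, the Ehrhart polynomial. $\mathrm{sgn}(x)\in\{ -1,0,+1\}$ denotes the sign of a real number $x$, with $\mathrm{sgn}(0)=0$. Throughout, dimensions $d$ are assumed to satisfy $d\ge3$. -}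

module Defs where

open import Data.Nat as ℕ using (ℕ; zero; suc)
open import Data.Integer as ℤ using (ℤ; +_; -[1+_])
open import Data.Rational as ℚ using (ℚ; 0ℚ; 1ℚ; _+_; _*_; _≤_; _<_)
open import Data.Rational.Properties using (_<?_)
open import Data.Fin using (Fin; zero; suc; toℕ)
open import Data.Vec using (Vec; lookup)
open import Data.List using (List; length)
open import Data.List.Membership.Propositional using (_∈_)
open import Data.List.Relation.Unary.Unique.Propositional using (Unique)
open import Data.Product using (Σ; _×_; ∃)
open import Relation.Binary.PropositionalEquality using (_≡_)
open import Relation.Nullary using (¬_; yes; no)
open import Function.Bundles using (_⇔_)

ℤtoℚ : ℤ → ℚ
ℤtoℚ z = z ℚ./ 1

ℕtoℚ : ℕ → ℚ
ℕtoℚ n = ℤtoℚ (+ n)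

_^ℚ_ : ℚ → ℕ → ℚ
q ^ℚ zero = 1ℚ
q ^ℚ suc n = q * (q ^ℚ n)

Σℚ : {n : ℕ} → (Fin n → ℚ) → ℚ
Σℚ {zero} f = 0ℚ
Σℚ {suc n} f = f zero + Σℚ (λ i → f (suc i))

sgn : ℚ → ℤ
sgn q with 0ℚ <? q
... | yes _ = + 1
... | no _ with q <? 0ℚ
...   | yes _ = -[1+ 0 ]
...   | no _ = + 0

Point : ℕ → Set
Point N = Vec ℤ N

-- An integral polytope in ℝ^N, given as the convex hull of a nonempty
-- finite family of integer points v 0, …, v k (the vertices are among them).
record IntPolytope (N : ℕ) : Set where
  constructor poly
  field
    k : ℕ
    v : Fin (suc k) → Point N
open IntPolytope public

InDilate : {N : ℕ} → ℕ → IntPolytope N → Point N → Set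
InDilate {N} t P x =
  Σ (Fin (suc (k P)) → ℚ) λ λs →
    ((j : Fin (suc (k P))) → 0ℚ ≤ λs j) ×
    (Σℚ λs ≡ ℕtoℚ t) ×
    ((c : Fin N) → Σℚ (λ j → λs j * ℤtoℚ (lookup (v P j) c)) ≡ ℤtoℚ (lookup x c))

AffIndep : {N : ℕ} (P : IntPolytope N) {m : ℕ} → (Fin m → Fin (suc (k P))) → Set
AffIndep {N} P {m} f =
  (μ : Fin m → ℚ) →
  Σℚ μ ≡ 0ℚ →
  ((c : Fin N) → Σℚ (λ i → μ i * ℤtoℚ (lookup (v P (f i)) c)) ≡ 0ℚ) →
  (i : Fin m) → μ i ≡ 0ℚ

-- P has dimension d: its affine hull (= affine hull of the generators) has
-- dimension d, i.e. some d+1 generators are affinely independent and no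
-- d+2 generators are.
HasDim : {N : ℕ} → IntPolytope N → ℕ → Set
HasDim P d =
  (Σ (Fin (suc d) → Fin (suc (k P))) λ f → AffIndep P f) ×
  ((f : Fin (suc (suc d)) → Fin (suc (k P))) → ¬ AffIndep P f)

-- Value of 1 + Σ_{i=1}^{n} c_i t^i, where c (toℕ j) is c_{j+1}.
EhrPoly : {n : ℕ} → (Fin n → ℚ) → ℕ → ℚ
EhrPoly c t = 1ℚ + Σℚ (λ j → c j * (ℕtoℚ t ^ℚ suc (toℕ j)))

HasEhrhart : {N n : ℕ} → IntPolytope N → (Fin n → ℚ) → Set
HasEhrhart {N} P c =
  (t : ℕ) → 1 ℕ.≤ t →
  Σ (List (Point N)) λ L →
    Unique L × ((x : Point N) → (x ∈ L) ⇔ InDilate t P x) ×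
    (ℕtoℚ (length L) ≡ EhrPoly c t)

-- coefficient c_i (1 ≤ i ≤ n) of a coefficient family; 0 outside that range
coef : {n : ℕ} → (Fin n → ℚ) → ℕ → ℚ
coef {zero} c i = 0ℚ
coef {suc n} c zero = 0ℚ
coef {suc n} c (suc zero) = c zero
coef {suc n} c (suc (suc i)) = coef (λ j → c (suc j)) (suc i)

{-# OPTIONS --safe #-}

-- Take for Q the product of P with a dilated Reeve tetrahedron T, with vertices (0,0,0), (l,0,0), (0,l,0),
-- (l,l,lm) and m = 6(s+2), whose Ehrhart polynomial is 1 - l s t + l² t² + l³ (2 + s) t³. Since Ehrhart
-- polynomials multiply, hᵢ = cᵢ - l s cᵢ₋₁ + l² cᵢ₋₂ + l³ (2 + s) cᵢ₋₃ with c₀ = 1. If l is large and s much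
-- larger than l, the last term dominates whenever i ≥ 3, while - l s cᵢ₋₁ dominates for i = 1, 2.
module Submission where

open import Defs
open import Data.Nat using (ℕ; _≤_; _+_; _∸_)
open import Data.Integer using (+_; -[1+_]; -_)
open import Data.Rational using (ℚ; 0ℚ)
open import Data.Fin using (Fin)
open import Data.Product using (Σ; _×_)
open import Relation.Binary.PropositionalEquality using (_≢_; _≡_)

open import Algebra.Bundles using (CommutativeRing)
open import Data.Nat as ℕ using (zero; suc)
import Data.Nat.DivMod as DivMod
import Data.Nat.Properties as ℕₚ
open import Data.Nat.Tactic.RingSolver using (solve-∀)
open import Data.Integer as ℤ using (ℤ)
import Data.Integer.Properties as ℤₚ
open import Data.Rational as ℚ using (1ℚ)
import Data.Rational.Properties as ℚₚ
open import Data.Rational.Solver using (module +-*-Solver)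
import Data.Rational.Unnormalised as ℚᵘ
import Data.Rational.Unnormalised.Properties as ℚᵘₚ
open import Data.Empty using (⊥; ⊥-elim)
open import Data.Fin using (zero; suc; toℕ; fromℕ<; combine; remQuot; punchIn; _↑ˡ_; _↑ʳ_; splitAt; join)
import Data.Fin.Properties as Finₚ
open import Data.List as List using (List; length; cartesianProductWith)
import Data.List.Properties as Listₚ
open import Data.List.Membership.Propositional using (_∈_)
import Data.List.Membership.Propositional.Properties as ∈ₚ
import Data.List.Relation.Unary.All as All
import Data.List.Relation.Unary.AllPairs as AllPairs
open import Data.List.Relation.Unary.Any using (here)
open import Data.List.Relation.Unary.Unique.Propositional using (Unique)
import Data.List.Relation.Unary.Unique.Propositional.Properties as Uniqueₚ
open import Data.Maybe using (Maybe; just; nothing)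
open import Data.Product using (∃; _,_; proj₁; proj₂)
open import Data.Sum using (_⊎_; inj₁; inj₂; [_,_]′)
open import Data.Vec as Vec using (Vec; []; _∷_; lookup)
import Data.Vec.Functional as VF
import Data.Vec.Functional.Properties as VFₚ
import Data.Vec.Properties as Vecₚ
open import Function using (_∘_; id)
open import Function.Bundles using (_⇔_; mk⇔; Equivalence)
open import Relation.Binary.Definitions using (tri<; tri≈; tri>)
open import Relation.Binary.PropositionalEquality using (refl; sym; trans; cong; cong₂; subst; module ≡-Reasoning)
open import Relation.Nullary using (¬_; yes; no)
import Algebra.Properties.CommutativeMonoid.Sum ℚₚ.+-0-commutativeMonoid as Sum
import Algebra.Properties.Semiring.Sum (CommutativeRing.semiring ℚₚ.+-*-commutativeRing) as *Sum

-- Finite sums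

-- The Reeve tetrahedron of height m has Ehrhart polynomial 1 + (2 - m/6) t + t² + (m/6) t³, so m =
-- 6 (s + 2) makes the coefficients integers and the linear one -s; dilating by l replaces t by l t.
-- Two parameters are needed because they do different work. The ratio of the cubic to the linear
-- coefficient is l² (1 + 2/s), so for large s only l can make the cubic term win; s in turn has to
-- beat the summand l² of h₂. How large they must be is read off from bounds 1/D ≤ |cᵢ| ≤ C, and the
-- lower one exists because every cᵢ is nonzero. The upper bound on the dimension is the delicate
-- half of `HasDim`, since P need not span its ambient space. It is a negative statement, so it is
-- proved by contradiction: the three coordinates of the tetrahedron are forgotten one at a time, at
-- the cost of at most one vertex each, until too many affinely independent vertices of P remain.

Σℚ≡sum : ∀ {n} (f : Fin n → ℚ) → Σℚ f ≡ Sum.sum f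
Σℚ≡sum {zero}  f = refl
Σℚ≡sum {suc n} f = cong (f zero ℚ.+_) (Σℚ≡sum (f ∘ suc))

Σℚ-cong : ∀ {n} {f g : Fin n → ℚ} → (∀ i → f i ≡ g i) → Σℚ f ≡ Σℚ g
Σℚ-cong {zero}  eq = refl
Σℚ-cong {suc n} eq = cong₂ ℚ._+_ (eq zero) (Σℚ-cong (eq ∘ suc))

Σℚ-zero : ∀ {n} {f : Fin n → ℚ} → (∀ i → f i ≡ 0ℚ) → Σℚ f ≡ 0ℚ
Σℚ-zero {zero}  eq = refl
Σℚ-zero {suc n} eq = cong₂ ℚ._+_ (eq zero) (Σℚ-zero (eq ∘ suc))

Σℚ-+ : ∀ {n} (f g : Fin n → ℚ) → Σℚ (λ i → f i ℚ.+ g i) ≡ Σℚ f ℚ.+ Σℚ g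
Σℚ-+ f g = begin
  Σℚ (λ i → f i ℚ.+ g i)      ≡⟨ Σℚ≡sum (λ i → f i ℚ.+ g i) ⟩
  Sum.sum (λ i → f i ℚ.+ g i) ≡⟨ Sum.∑-distrib-+ f g ⟩
  Sum.sum f ℚ.+ Sum.sum g     ≡⟨ cong₂ ℚ._+_ (Σℚ≡sum f) (Σℚ≡sum g) ⟨
  Σℚ f ℚ.+ Σℚ g               ∎
  where open ≡-Reasoning

Σℚ-*ˡ : ∀ {n} q (f : Fin n → ℚ) → Σℚ (λ i → q ℚ.* f i) ≡ q ℚ.* Σℚ f
Σℚ-*ˡ q f = begin
  Σℚ (λ i → q ℚ.* f i)      ≡⟨ Σℚ≡sum (λ i → q ℚ.* f i) ⟩
  Sum.sum (λ i → q ℚ.* f i) ≡⟨ *Sum.*-distribˡ-sum q f ⟨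
  q ℚ.* Sum.sum f           ≡⟨ cong (q ℚ.*_) (Σℚ≡sum f) ⟨
  q ℚ.* Σℚ f                ∎
  where open ≡-Reasoning

Σℚ-*ʳ : ∀ {n} (f : Fin n → ℚ) q → Σℚ (λ i → f i ℚ.* q) ≡ Σℚ f ℚ.* q
Σℚ-*ʳ f q = begin
  Σℚ (λ i → f i ℚ.* q) ≡⟨ Σℚ-cong (λ i → ℚₚ.*-comm (f i) q) ⟩
  Σℚ (λ i → q ℚ.* f i) ≡⟨ Σℚ-*ˡ q f ⟩
  q ℚ.* Σℚ f           ≡⟨ ℚₚ.*-comm q (Σℚ f) ⟩
  Σℚ f ℚ.* q           ∎
  where open ≡-Reasoning

Σℚ-*1 : ∀ {n} (f : Fin n → ℚ) → Σℚ (λ i → f i ℚ.* 1ℚ) ≡ Σℚ f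
Σℚ-*1 f = Σℚ-cong (λ i → ℚₚ.*-identityʳ (f i))

Σℚ-swap : ∀ {m n} (f : Fin m → Fin n → ℚ) →
  Σℚ (λ i → Σℚ (f i)) ≡ Σℚ (λ j → Σℚ (λ i → f i j))
Σℚ-swap f = begin
  Σℚ (λ i → Σℚ (f i))                 ≡⟨ double f ⟩
  Sum.sum (λ i → Sum.sum (f i))       ≡⟨ Sum.∑-comm f ⟩
  Sum.sum (λ j → Sum.sum (λ i → f i j)) ≡⟨ double (λ j i → f i j) ⟨
  Σℚ (λ j → Σℚ (λ i → f i j))         ∎
  where
  open ≡-Reasoning
  double : ∀ {m n} (g : Fin m → Fin n → ℚ) → Σℚ (λ i → Σℚ (g i)) ≡ Sum.sum (λ i → Sum.sum (g i))
  double g = trans (Σℚ-cong (Σℚ≡sum ∘ g)) (Σℚ≡sum (λ i → Sum.sum (g i)))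

Σℚ-punchIn : ∀ {n} (i : Fin (suc n)) (f : Fin (suc n) → ℚ) → Σℚ f ≡ f i ℚ.+ Σℚ (f ∘ punchIn i)
Σℚ-punchIn i f = begin
  Σℚ f                                ≡⟨ Σℚ≡sum f ⟩
  Sum.sum f                           ≡⟨ Sum.sum-remove {i = i} f ⟩
  f i ℚ.+ Sum.sum (f ∘ punchIn i)     ≡⟨ cong (f i ℚ.+_) (Σℚ≡sum (f ∘ punchIn i)) ⟨
  f i ℚ.+ Σℚ (f ∘ punchIn i)          ∎
  where open ≡-Reasoning

Σℚ-nonNeg : ∀ {n} {f : Fin n → ℚ} → (∀ i → 0ℚ ℚ.≤ f i) → 0ℚ ℚ.≤ Σℚ f
Σℚ-nonNeg {zero}  f≥0 = ℚₚ.≤-refl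
Σℚ-nonNeg {suc n} f≥0 = ℚₚ.+-mono-≤ (f≥0 zero) (Σℚ-nonNeg (f≥0 ∘ suc))

Σℚ-++ : ∀ m {n} (f : Fin (m + n) → ℚ) → Σℚ f ≡ Σℚ (λ i → f (i ↑ˡ n)) ℚ.+ Σℚ (λ j → f (m ↑ʳ j))
Σℚ-++ zero    f = sym (ℚₚ.+-identityˡ _)
Σℚ-++ (suc m) {n} f = trans (cong (f zero ℚ.+_) (Σℚ-++ m (f ∘ suc)))
  (sym (ℚₚ.+-assoc (f zero) (Σℚ (λ i → f (suc (i ↑ˡ n)))) (Σℚ (λ j → f (suc (m ↑ʳ j))))))

Σℚ-combine : ∀ m {n} (f : Fin (m ℕ.* n) → ℚ) → Σℚ f ≡ Σℚ (λ i → Σℚ (λ j → f (combine {m} i j)))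
Σℚ-combine zero        f = refl
Σℚ-combine (suc m) {n} f = trans (Σℚ-++ n f) 
  (cong (Σℚ (λ j → f (j ↑ˡ (m ℕ.* n))) ℚ.+_) (Σℚ-combine m (f ∘ (n ↑ʳ_))))

0≤p*q : ∀ {p q} → 0ℚ ℚ.≤ p → 0ℚ ℚ.≤ q → 0ℚ ℚ.≤ p ℚ.* q
0≤p*q {p} {q} 0≤p 0≤q =
  ℚₚ.nonNegative⁻¹ _ {{ℚₚ.nonNeg*nonNeg⇒nonNeg p {{ℚ.nonNegative 0≤p}} q {{ℚ.nonNegative 0≤q}}}}

-- Products of polytopes

infixr 7 _⊗_

-- `suc k` of the product unfolds to `suc (k P) * suc (k Q)`, so `remQuot` and `combine` identify
-- its vertices with pairs of vertices without any transport.
_⊗_ : ∀ {M N} → IntPolytope M → IntPolytope N → IntPolytope (M + N)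
P ⊗ Q = poly (k Q + k P ℕ.* suc (k Q)) λ i →
  v P (proj₁ (remQuot {suc (k P)} (suc (k Q)) i)) Vec.++ v Q (proj₂ (remQuot {suc (k P)} (suc (k Q)) i))

module _ {M N} (P : IntPolytope M) (Q : IntPolytope N) where

  private
    fst : Fin (suc (k (P ⊗ Q))) → Fin (suc (k P))
    fst i = proj₁ (remQuot {suc (k P)} (suc (k Q)) i)

    snd : Fin (suc (k (P ⊗ Q))) → Fin (suc (k Q))
    snd i = proj₂ (remQuot {suc (k P)} (suc (k Q)) i)

  pair : Fin (suc (k P)) → Fin (suc (k Q)) → Fin (suc (k (P ⊗ Q)))
  pair = combine

  v-pair : ∀ i j → v (P ⊗ Q) (pair i j) ≡ v P i Vec.++ v Q j
  v-pair i j = cong (λ p → v P (proj₁ p) Vec.++ v Q (proj₂ p)) (Finₚ.remQuot-combine {suc (k P)} i j)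

  lookup-v-pairˡ : ∀ i j c → lookup (v (P ⊗ Q) (pair i j)) (c ↑ˡ N) ≡ lookup (v P i) c
  lookup-v-pairˡ i j c = trans (cong (λ x → lookup x (c ↑ˡ N)) (v-pair i j)) (Vecₚ.lookup-++ˡ (v P i) (v Q j) c)

  lookup-v-pairʳ : ∀ i j c → lookup (v (P ⊗ Q) (pair i j)) (M ↑ʳ c) ≡ lookup (v Q j) c
  lookup-v-pairʳ i j c = trans (cong (λ x → lookup x (M ↑ʳ c)) (v-pair i j)) (Vecₚ.lookup-++ʳ (v P i) (v Q j) c)

  -- The marginals of the joint weights serve as weights on the two factors.
  InDilate-⊗⁻ : ∀ t x y → InDilate t (P ⊗ Q) (x Vec.++ y) → InDilate t P x × InDilate t Q y
  InDilate-⊗⁻ t x y (ν , ν≥0 , Σν≡t , ν-coord) =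
    ( (λ i → Σℚ (λ j → ν (pair i j))) , (λ i → Σℚ-nonNeg (λ j → ν≥0 (pair i j)))
    , trans (sym (Σℚ-combine (suc (k P)) ν)) Σν≡t , coordˡ ) ,
    ( (λ j → Σℚ (λ i → ν (pair i j))) , (λ j → Σℚ-nonNeg (λ i → ν≥0 (pair i j)))
    , trans (sym (Σℚ-swap (λ i j → ν (pair i j)))) (trans (sym (Σℚ-combine (suc (k P)) ν)) Σν≡t) , coordʳ )
    where
    open ≡-Reasoning
    coordˡ : ∀ c → Σℚ (λ i → Σℚ (λ j → ν (pair i j)) ℚ.* ℤtoℚ (lookup (v P i) c)) ≡ ℤtoℚ (lookup x c)
    coordˡ c = begin
      Σℚ (λ i → Σℚ (λ j → ν (pair i j)) ℚ.* ℤtoℚ (lookup (v P i) c))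
        ≡⟨ Σℚ-cong (λ i → sym (Σℚ-*ʳ (λ j → ν (pair i j)) (ℤtoℚ (lookup (v P i) c)))) ⟩
      Σℚ (λ i → Σℚ (λ j → ν (pair i j) ℚ.* ℤtoℚ (lookup (v P i) c)))
        ≡⟨ Σℚ-cong (λ i → Σℚ-cong (λ j → cong (λ z → ν (pair i j) ℚ.* ℤtoℚ z) (sym (lookup-v-pairˡ i j c)))) ⟩
      Σℚ (λ i → Σℚ (λ j → ν (pair i j) ℚ.* ℤtoℚ (lookup (v (P ⊗ Q) (pair i j)) (c ↑ˡ N))))
        ≡⟨ Σℚ-combine (suc (k P)) (λ p → ν p ℚ.* ℤtoℚ (lookup (v (P ⊗ Q) p) (c ↑ˡ N))) ⟨
      Σℚ (λ p → ν p ℚ.* ℤtoℚ (lookup (v (P ⊗ Q) p) (c ↑ˡ N)))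
        ≡⟨ ν-coord (c ↑ˡ N) ⟩
      ℤtoℚ (lookup (x Vec.++ y) (c ↑ˡ N))
        ≡⟨ cong ℤtoℚ (Vecₚ.lookup-++ˡ x y c) ⟩
      ℤtoℚ (lookup x c) ∎
    coordʳ : ∀ c → Σℚ (λ j → Σℚ (λ i → ν (pair i j)) ℚ.* ℤtoℚ (lookup (v Q j) c)) ≡ ℤtoℚ (lookup y c)
    coordʳ c = begin
      Σℚ (λ j → Σℚ (λ i → ν (pair i j)) ℚ.* ℤtoℚ (lookup (v Q j) c))
        ≡⟨ Σℚ-cong (λ j → sym (Σℚ-*ʳ (λ i → ν (pair i j)) (ℤtoℚ (lookup (v Q j) c)))) ⟩
      Σℚ (λ j → Σℚ (λ i → ν (pair i j) ℚ.* ℤtoℚ (lookup (v Q j) c)))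
        ≡⟨ Σℚ-swap (λ i j → ν (pair i j) ℚ.* ℤtoℚ (lookup (v Q j) c)) ⟨
      Σℚ (λ i → Σℚ (λ j → ν (pair i j) ℚ.* ℤtoℚ (lookup (v Q j) c)))
        ≡⟨ Σℚ-cong (λ i → Σℚ-cong (λ j → cong (λ z → ν (pair i j) ℚ.* ℤtoℚ z) (sym (lookup-v-pairʳ i j c)))) ⟩
      Σℚ (λ i → Σℚ (λ j → ν (pair i j) ℚ.* ℤtoℚ (lookup (v (P ⊗ Q) (pair i j)) (M ↑ʳ c))))
        ≡⟨ Σℚ-combine (suc (k P)) (λ p → ν p ℚ.* ℤtoℚ (lookup (v (P ⊗ Q) p) (M ↑ʳ c))) ⟨
      Σℚ (λ p → ν p ℚ.* ℤtoℚ (lookup (v (P ⊗ Q) p) (M ↑ʳ c)))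
        ≡⟨ ν-coord (M ↑ʳ c) ⟩
      ℤtoℚ (lookup (x Vec.++ y) (M ↑ʳ c))
        ≡⟨ cong ℤtoℚ (Vecₚ.lookup-++ʳ x y c) ⟩
      ℤtoℚ (lookup y c) ∎

  -- The weight of a pair of vertices is the product of their weights divided by t.
  InDilate-⊗⁺ : ∀ t x y → 1 ≤ t → InDilate t P x → InDilate t Q y → InDilate t (P ⊗ Q) (x Vec.++ y)
  InDilate-⊗⁺ t x y 1≤t (λs , λ≥0 , Σλ≡t , λ-coord) (μs , μ≥0 , Σμ≡t , μ-coord) =
    ν , (λ p → 0≤p*q (0≤p*q (λ≥0 (fst p)) (μ≥0 (snd p))) 1/t≥0) , Σν≡t , coord
    where
    open ≡-Reasoning
    T : ℚ
    T = ℕtoℚ t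
    instance
      T>0 : ℚ.Positive T
      T>0 = positive 1≤t
        where
        positive : ∀ {n} → 1 ≤ n → ℚ.Positive (ℕtoℚ n)
        positive {suc n} _ = ℚₚ.normalize-pos (suc n) 1
      T≢0 : ℚ.NonZero T
      T≢0 = ℚₚ.pos⇒nonZero T
    1/t≥0 : 0ℚ ℚ.≤ ℚ.1/ T
    1/t≥0 = ℚₚ.<⇒≤ (ℚₚ.positive⁻¹ (ℚ.1/ T) {{ℚₚ.1/pos⇒pos T}})
    ν : Fin (suc (k (P ⊗ Q))) → ℚ
    ν p = λs (fst p) ℚ.* μs (snd p) ℚ.* ℚ.1/ T
    ν-pair : ∀ i j → ν (pair i j) ≡ λs i ℚ.* μs j ℚ.* ℚ.1/ T
    ν-pair i j = cong (λ p → λs (proj₁ p) ℚ.* μs (proj₂ p) ℚ.* ℚ.1/ T) (Finₚ.remQuot-combine {suc (k P)} i j)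
    -- Fubini for product weights. When one of the two functions is constantly 1, its weighted sum
    -- is `T`, which cancels the factor `1/ T`; this yields both marginals below.
    ΣΣ : (φ : Fin (suc (k P)) → ℚ) (ψ : Fin (suc (k Q)) → ℚ) (χ : Fin (suc (k (P ⊗ Q))) → ℚ) →
      (∀ i j → χ (pair i j) ≡ φ i ℚ.* ψ j) →
      Σℚ (λ p → ν p ℚ.* χ p) ≡ Σℚ (λ i → λs i ℚ.* φ i) ℚ.* (Σℚ (λ j → μs j ℚ.* ψ j) ℚ.* ℚ.1/ T)
    ΣΣ φ ψ χ χ≡ = begin
      Σℚ (λ p → ν p ℚ.* χ p)
        ≡⟨ Σℚ-combine (suc (k P)) (λ p → ν p ℚ.* χ p) ⟩
      Σℚ (λ i → Σℚ (λ j → ν (pair i j) ℚ.* χ (pair i j)))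
        ≡⟨ Σℚ-cong (λ i → Σℚ-cong (λ j → trans (cong₂ ℚ._*_ (ν-pair i j) (χ≡ i j))
             (rearrange (λs i) (μs j) (ℚ.1/ T) (φ i) (ψ j)))) ⟩
      Σℚ (λ i → Σℚ (λ j → (λs i ℚ.* φ i) ℚ.* ((μs j ℚ.* ψ j) ℚ.* ℚ.1/ T)))
        ≡⟨ Σℚ-cong (λ i → trans (Σℚ-*ˡ (λs i ℚ.* φ i) (λ j → (μs j ℚ.* ψ j) ℚ.* ℚ.1/ T))
             (cong (λs i ℚ.* φ i ℚ.*_) (Σℚ-*ʳ (λ j → μs j ℚ.* ψ j) (ℚ.1/ T)))) ⟩
      Σℚ (λ i → (λs i ℚ.* φ i) ℚ.* (Σℚ (λ j → μs j ℚ.* ψ j) ℚ.* ℚ.1/ T))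
        ≡⟨ Σℚ-*ʳ (λ i → λs i ℚ.* φ i) _ ⟩
      Σℚ (λ i → λs i ℚ.* φ i) ℚ.* (Σℚ (λ j → μs j ℚ.* ψ j) ℚ.* ℚ.1/ T) ∎
      where
      open +-*-Solver
      rearrange : ∀ a b u p q → a ℚ.* b ℚ.* u ℚ.* (p ℚ.* q) ≡ (a ℚ.* p) ℚ.* ((b ℚ.* q) ℚ.* u)
      rearrange = solve 5 (λ a b u p q → a :* b :* u :* (p :* q) := (a :* p) :* ((b :* q) :* u)) refl
    marginalˡ : ∀ φ χ → (∀ i j → χ (pair i j) ≡ φ i) → Σℚ (λ p → ν p ℚ.* χ p) ≡ Σℚ (λ i → λs i ℚ.* φ i)
    marginalˡ φ χ χ≡ = begin
      Σℚ (λ p → ν p ℚ.* χ p)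
        ≡⟨ ΣΣ φ (λ _ → 1ℚ) χ (λ i j → trans (χ≡ i j) (sym (ℚₚ.*-identityʳ (φ i)))) ⟩
      S ℚ.* (Σℚ (λ j → μs j ℚ.* 1ℚ) ℚ.* ℚ.1/ T)
        ≡⟨ cong (λ z → S ℚ.* (z ℚ.* ℚ.1/ T)) (trans (Σℚ-*1 μs) Σμ≡t) ⟩
      S ℚ.* (T ℚ.* ℚ.1/ T) ≡⟨ cong (S ℚ.*_) (ℚₚ.*-inverseʳ T) ⟩
      S ℚ.* 1ℚ             ≡⟨ ℚₚ.*-identityʳ S ⟩
      S ∎
      where S = Σℚ (λ i → λs i ℚ.* φ i)
    marginalʳ : ∀ ψ χ → (∀ i j → χ (pair i j) ≡ ψ j) → Σℚ (λ p → ν p ℚ.* χ p) ≡ Σℚ (λ j → μs j ℚ.* ψ j)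
    marginalʳ ψ χ χ≡ = begin
      Σℚ (λ p → ν p ℚ.* χ p)
        ≡⟨ ΣΣ (λ _ → 1ℚ) ψ χ (λ i j → trans (χ≡ i j) (sym (ℚₚ.*-identityˡ (ψ j)))) ⟩
      Σℚ (λ i → λs i ℚ.* 1ℚ) ℚ.* (S ℚ.* ℚ.1/ T)
        ≡⟨ cong (ℚ._* (S ℚ.* ℚ.1/ T)) (trans (Σℚ-*1 λs) Σλ≡t) ⟩
      T ℚ.* (S ℚ.* ℚ.1/ T)   ≡⟨ ℚₚ.*-comm T _ ⟩
      S ℚ.* ℚ.1/ T ℚ.* T     ≡⟨ ℚₚ.*-assoc S (ℚ.1/ T) T ⟩
      S ℚ.* (ℚ.1/ T ℚ.* T)   ≡⟨ cong (S ℚ.*_) (ℚₚ.*-inverseˡ T) ⟩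
      S ℚ.* 1ℚ               ≡⟨ ℚₚ.*-identityʳ S ⟩
      S ∎
      where S = Σℚ (λ j → μs j ℚ.* ψ j)
    Σν≡t : Σℚ ν ≡ T
    Σν≡t = begin
      Σℚ ν                   ≡⟨ Σℚ-*1 ν ⟨
      Σℚ (λ p → ν p ℚ.* 1ℚ)  ≡⟨ marginalˡ (λ _ → 1ℚ) (λ _ → 1ℚ) (λ _ _ → refl) ⟩
      Σℚ (λ i → λs i ℚ.* 1ℚ) ≡⟨ Σℚ-*1 λs ⟩
      Σℚ λs                  ≡⟨ Σλ≡t ⟩
      T ∎
    coord-split : ∀ (s : Fin M ⊎ Fin N) → let c = join M N s in
      Σℚ (λ p → ν p ℚ.* ℤtoℚ (lookup (v (P ⊗ Q) p) c)) ≡ ℤtoℚ (lookup (x Vec.++ y) c)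
    coord-split (inj₁ c) = begin
      Σℚ (λ p → ν p ℚ.* ℤtoℚ (lookup (v (P ⊗ Q) p) (c ↑ˡ N)))
        ≡⟨ marginalˡ (λ i → ℤtoℚ (lookup (v P i) c)) (λ p → ℤtoℚ (lookup (v (P ⊗ Q) p) (c ↑ˡ N)))
             (λ i j → cong ℤtoℚ (lookup-v-pairˡ i j c)) ⟩
      Σℚ (λ i → λs i ℚ.* ℤtoℚ (lookup (v P i) c)) ≡⟨ λ-coord c ⟩
      ℤtoℚ (lookup x c)                           ≡⟨ cong ℤtoℚ (Vecₚ.lookup-++ˡ x y c) ⟨
      ℤtoℚ (lookup (x Vec.++ y) (c ↑ˡ N)) ∎
    coord-split (inj₂ c) = begin
      Σℚ (λ p → ν p ℚ.* ℤtoℚ (lookup (v (P ⊗ Q) p) (M ↑ʳ c)))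
        ≡⟨ marginalʳ (λ j → ℤtoℚ (lookup (v Q j) c)) (λ p → ℤtoℚ (lookup (v (P ⊗ Q) p) (M ↑ʳ c)))
             (λ i j → cong ℤtoℚ (lookup-v-pairʳ i j c)) ⟩
      Σℚ (λ j → μs j ℚ.* ℤtoℚ (lookup (v Q j) c)) ≡⟨ μ-coord c ⟩
      ℤtoℚ (lookup y c)                           ≡⟨ cong ℤtoℚ (Vecₚ.lookup-++ʳ x y c) ⟨
      ℤtoℚ (lookup (x Vec.++ y) (M ↑ʳ c)) ∎
    coord : ∀ c → Σℚ (λ p → ν p ℚ.* ℤtoℚ (lookup (v (P ⊗ Q) p) c)) ≡ ℤtoℚ (lookup (x Vec.++ y) c)
    coord c = subst (λ c → Σℚ (λ p → ν p ℚ.* ℤtoℚ (lookup (v (P ⊗ Q) p) c)) ≡ ℤtoℚ (lookup (x Vec.++ y) c))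
      (Finₚ.join-splitAt M N c) (coord-split (splitAt M c))

length-cartesianProductWith : ∀ {A B C : Set} (f : A → B → C) xs ys →
  length (cartesianProductWith f xs ys) ≡ length xs ℕ.* length ys
length-cartesianProductWith f List.[]       ys = refl
length-cartesianProductWith f (x List.∷ xs) ys = trans (Listₚ.length-++ (List.map (f x) ys))
  (cong₂ _+_ (Listₚ.length-map (f x) ys) (length-cartesianProductWith f xs ys))

Enumerates : ∀ {N} → ℕ → IntPolytope N → List (Point N) → Set
Enumerates t P L = Unique L × (∀ x → (x ∈ L) ⇔ InDilate t P x)

Enumerates-⊗ : ∀ {M N} (P : IntPolytope M) (Q : IntPolytope N) {t L K} → 1 ≤ t →
  Enumerates t P L → Enumerates t Q K → Enumerates t (P ⊗ Q) (cartesianProductWith Vec._++_ L K)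
Enumerates-⊗ {M} P Q {t} {L} {K} 1≤t (L! , L⇔) (K! , K⇔) =
  Uniqueₚ.cartesianProductWith⁺ Vec._++_ (λ {a} {b} → Vecₚ.++-injective a b) L! K! ,
  λ x → mk⇔ (to x) (from x)
  where
  to : ∀ x → x ∈ cartesianProductWith Vec._++_ L K → InDilate t (P ⊗ Q) x
  to x x∈ with ∈ₚ.∈-cartesianProductWith⁻ Vec._++_ L K x∈
  ... | a , b , a∈ , b∈ , refl =
    InDilate-⊗⁺ P Q t a b 1≤t (Equivalence.to (L⇔ a) a∈) (Equivalence.to (K⇔ b) b∈)
  from : ∀ x → InDilate t (P ⊗ Q) x → x ∈ cartesianProductWith Vec._++_ L K
  from x x∈ with Vec.splitAt M x
  ... | a , b , refl = ∈ₚ.∈-cartesianProductWith⁺ Vec._++_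
    (Equivalence.from (L⇔ a) (proj₁ both)) (Equivalence.from (K⇔ b) (proj₂ both))
    where both = InDilate-⊗⁻ P Q t a b x∈

p*q≡0∧q≢0⇒p≡0 : ∀ p {q} → q ≢ 0ℚ → p ℚ.* q ≡ 0ℚ → p ≡ 0ℚ
p*q≡0∧q≢0⇒p≡0 p {q} q≢0 pq≡0 = begin
  p                      ≡⟨ ℚₚ.*-identityʳ p ⟨
  p ℚ.* 1ℚ               ≡⟨ cong (p ℚ.*_) (ℚₚ.*-inverseʳ q) ⟨
  p ℚ.* (q ℚ.* ℚ.1/ q)   ≡⟨ ℚₚ.*-assoc p q (ℚ.1/ q) ⟨
  p ℚ.* q ℚ.* ℚ.1/ q     ≡⟨ cong (ℚ._* ℚ.1/ q) pq≡0 ⟩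
  0ℚ ℚ.* ℚ.1/ q          ≡⟨ ℚₚ.*-zeroˡ (ℚ.1/ q) ⟩
  0ℚ ∎
  where
  open ≡-Reasoning
  instance _ = ℚ.≢-nonZero q≢0

-- Linear independence

-- The coordinates are indexed by an arbitrary set, so that some can be split off with a sum type
-- and an extra one can be adjoined with `Maybe`.
Indep : {I : Set} {m : ℕ} → (Fin m → I → ℚ) → Set
Indep {I} {m} u = (μ : Fin m → ℚ) → (∀ c → Σℚ (λ i → μ i ℚ.* u i c) ≡ 0ℚ) → ∀ i → μ i ≡ 0ℚ

Σℚ-linear : ∀ {n} a b (f g h : Fin n → ℚ) →
  Σℚ (λ i → (a ℚ.* f i ℚ.+ b ℚ.* g i) ℚ.* h i)
    ≡ a ℚ.* Σℚ (λ i → f i ℚ.* h i) ℚ.+ b ℚ.* Σℚ (λ i → g i ℚ.* h i)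
Σℚ-linear a b f g h = begin
  Σℚ (λ i → (a ℚ.* f i ℚ.+ b ℚ.* g i) ℚ.* h i)
    ≡⟨ Σℚ-cong (λ i → distrib a b (f i) (g i) (h i)) ⟩
  Σℚ (λ i → a ℚ.* (f i ℚ.* h i) ℚ.+ b ℚ.* (g i ℚ.* h i))
    ≡⟨ Σℚ-+ (λ i → a ℚ.* (f i ℚ.* h i)) (λ i → b ℚ.* (g i ℚ.* h i)) ⟩
  Σℚ (λ i → a ℚ.* (f i ℚ.* h i)) ℚ.+ Σℚ (λ i → b ℚ.* (g i ℚ.* h i))
    ≡⟨ cong₂ ℚ._+_ (Σℚ-*ˡ a (λ i → f i ℚ.* h i)) (Σℚ-*ˡ b (λ i → g i ℚ.* h i)) ⟩
  a ℚ.* Σℚ (λ i → f i ℚ.* h i) ℚ.+ b ℚ.* Σℚ (λ i → g i ℚ.* h i) ∎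
  where
  open ≡-Reasoning
  open +-*-Solver
  distrib : ∀ a b p q r → (a ℚ.* p ℚ.+ b ℚ.* q) ℚ.* r ≡ a ℚ.* (p ℚ.* r) ℚ.+ b ℚ.* (q ℚ.* r)
  distrib = solve 5 (λ a b p q r → (a :* p :+ b :* q) :* r := a :* (p :* r) :+ b :* (q :* r)) refl

extend : ∀ {n} → Fin (suc n) → (Fin n → ℚ) → Fin (suc n) → ℚ
extend i ν = VF.insertAt ν i 0ℚ

Σℚ-extend : ∀ {n} (i : Fin (suc n)) (ν : Fin n → ℚ) (f : Fin (suc n) → ℚ) →
  Σℚ (λ j → extend i ν j ℚ.* f j) ≡ Σℚ (λ j → ν j ℚ.* f (punchIn i j))
Σℚ-extend i ν f = begin
  Σℚ (λ j → extend i ν j ℚ.* f j)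
    ≡⟨ Σℚ-punchIn i (λ j → extend i ν j ℚ.* f j) ⟩
  extend i ν i ℚ.* f i ℚ.+ Σℚ (λ j → extend i ν (punchIn i j) ℚ.* f (punchIn i j))
    ≡⟨ cong₂ ℚ._+_ (trans (cong (ℚ._* f i) (VFₚ.insertAt-lookup ν i 0ℚ)) (ℚₚ.*-zeroˡ (f i)))
         (Σℚ-cong (λ j → cong (ℚ._* f (punchIn i j)) (VFₚ.insertAt-punchIn ν i 0ℚ j))) ⟩
  0ℚ ℚ.+ Σℚ (λ j → ν j ℚ.* f (punchIn i j))
    ≡⟨ ℚₚ.+-identityˡ _ ⟩
  Σℚ (λ j → ν j ℚ.* f (punchIn i j)) ∎
  where open ≡-Reasoning

-- Forgetting one coordinate e of an independent family costs at most one vector: if μ is a relation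
-- of the remaining coordinates with μ i ≠ 0, then removing the i-th vector restores independence.
forget-coordinate : ∀ {I : Set} {n} (e : Fin (suc n) → ℚ) (u : Fin (suc n) → I → ℚ) →
  (∀ μ → (∀ c → Σℚ (λ i → μ i ℚ.* u i c) ≡ 0ℚ) → Σℚ (λ i → μ i ℚ.* e i) ≡ 0ℚ → ∀ i → μ i ≡ 0ℚ) →
  (∀ i → ¬ Indep (u ∘ punchIn i)) → ⊥
-- If no relation among the `u i` has a nonzero weight, then `u` itself is independent and any
-- vector may be removed, here the one at `zero`.
forget-coordinate {I} {n} e u joint dep = dep zero
  (λ ν νu≡0 j → trans (sym (VFₚ.insertAt-punchIn ν zero 0ℚ j))
    (indep (extend zero ν) (λ c → trans (Σℚ-extend zero ν (λ i → u i c)) (νu≡0 c)) (punchIn zero j)))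
  where
  open ≡-Reasoning
  remove : ∀ μ → (∀ c → Σℚ (λ i → μ i ℚ.* u i c) ≡ 0ℚ) → ∀ i → μ i ≢ 0ℚ → Indep (u ∘ punchIn i)
  remove μ μu≡0 i μi≢0 ν νu≡0 j = trans (sym (VFₚ.insertAt-punchIn ν i 0ℚ j))
    (joint ν′ ν′u≡0 β≡0 (punchIn i j))
    where
    ν′ : Fin (suc n) → ℚ
    ν′ = extend i ν
    α β : ℚ
    α = Σℚ (λ i → μ i ℚ.* e i)
    β = Σℚ (λ i → ν′ i ℚ.* e i)
    ν′u≡0 : ∀ c → Σℚ (λ i → ν′ i ℚ.* u i c) ≡ 0ℚ
    ν′u≡0 c = trans (Σℚ-extend i ν (λ i → u i c)) (νu≡0 c)
    -- This combination of the two relations is chosen so that its value on `e` is αβ - βα = 0;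
    -- hence `κ` vanishes. At `i` the weight `ν′ i` is 0, which leaves -β μᵢ = 0 and so β = 0: `ν′`
    -- is a relation of `e` too.
    κ : Fin (suc n) → ℚ
    κ j = α ℚ.* ν′ j ℚ.+ (ℚ.- β) ℚ.* μ j
    open +-*-Solver
    κu≡0 : ∀ c → Σℚ (λ i → κ i ℚ.* u i c) ≡ 0ℚ
    κu≡0 c = begin
      Σℚ (λ i → κ i ℚ.* u i c)
        ≡⟨ Σℚ-linear α (ℚ.- β) ν′ μ (λ i → u i c) ⟩
      α ℚ.* Σℚ (λ i → ν′ i ℚ.* u i c) ℚ.+ (ℚ.- β) ℚ.* Σℚ (λ i → μ i ℚ.* u i c)
        ≡⟨ cong₂ (λ a b → α ℚ.* a ℚ.+ (ℚ.- β) ℚ.* b) (ν′u≡0 c) (μu≡0 c) ⟩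
      α ℚ.* 0ℚ ℚ.+ (ℚ.- β) ℚ.* 0ℚ
        ≡⟨ cong₂ ℚ._+_ (ℚₚ.*-zeroʳ α) (ℚₚ.*-zeroʳ (ℚ.- β)) ⟩
      0ℚ ∎
    κe≡0 : Σℚ (λ i → κ i ℚ.* e i) ≡ 0ℚ
    κe≡0 = trans (Σℚ-linear α (ℚ.- β) ν′ μ e)
      (solve 2 (λ a b → a :* b :+ (:- b) :* a := con 0ℚ) refl α β)
    -β≡0 : ℚ.- β ≡ 0ℚ
    -β≡0 = p*q≡0∧q≢0⇒p≡0 (ℚ.- β) μi≢0 (begin
      (ℚ.- β) ℚ.* μ i                      ≡⟨ ℚₚ.+-identityˡ _ ⟨
      0ℚ ℚ.+ (ℚ.- β) ℚ.* μ i               ≡⟨ cong (ℚ._+ (ℚ.- β) ℚ.* μ i) (ℚₚ.*-zeroʳ α) ⟨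
      α ℚ.* 0ℚ ℚ.+ (ℚ.- β) ℚ.* μ i         ≡⟨ cong (λ z → α ℚ.* z ℚ.+ (ℚ.- β) ℚ.* μ i) (VFₚ.insertAt-lookup ν i 0ℚ) ⟨
      κ i                                  ≡⟨ joint κ κu≡0 κe≡0 i ⟩
      0ℚ ∎)
    β≡0 : β ≡ 0ℚ
    β≡0 = ℚₚ.neg-injective -β≡0
  indep : Indep u
  indep μ μu≡0 i with μ i ℚₚ.≟ 0ℚ
  ... | yes μi≡0 = μi≡0
  ... | no  μi≢0 = ⊥-elim (dep i (remove μ μu≡0 i μi≢0))

-- Induction on `M`, each coordinate costing one vector. The surviving vectors are not exhibited,
-- because finding them would require deciding whether a relation exists; refuting their absence is
-- enough for a negative dimension bound.
forget-coordinates : ∀ M {n} {I : Set} (e : Fin (M + n) → Fin M → ℚ) (u : Fin (M + n) → I → ℚ) →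
  Indep (λ i → [ e i , u i ]′) → (∀ (g : Fin n → Fin (M + n)) → ¬ Indep (u ∘ g)) → ⊥
forget-coordinates zero    e u joint dep = dep id (λ μ μu≡0 → joint μ (λ { (inj₂ c) → μu≡0 c }))
forget-coordinates (suc M) e u joint dep =
  forget-coordinate (λ i → e i zero) (λ i → [ e i ∘ suc , u i ]′)
    (λ μ μu≡0 μe≡0 → joint μ (λ { (inj₁ zero) → μe≡0 ; (inj₁ (suc c)) → μu≡0 (inj₁ c) ; (inj₂ c) → μu≡0 (inj₂ c) }))
    (λ i ind → forget-coordinates M (λ j → e (punchIn i j) ∘ suc) (u ∘ punchIn i) ind (λ g → dep (punchIn i ∘ g)))

-- Dimension of a product

module _ {M N} (P : IntPolytope M) (Q : IntPolytope N) where

  -- Among `M + n` affinely independent vertices of the product, forgetting the `M` coordinates that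
  -- come from `P` would leave `n` vertices whose components in `Q` are affinely independent.
  ¬AffIndep-⊗ : ∀ {n} → (∀ (g : Fin n → Fin (suc (k Q))) → ¬ AffIndep Q g) →
    ∀ (F : Fin (M + n) → Fin (suc (k (P ⊗ Q)))) → ¬ AffIndep (P ⊗ Q) F
  ¬AffIndep-⊗ {n} dep F indep = forget-coordinates M e u joint
    (λ g ind → dep (λ i → proj₂ (rq (F (g i))))
      (λ μ Σμ≡0 coord → ind μ (λ { nothing → trans (Σℚ-*1 μ) Σμ≡0 ; (just c) → coord c })))
    where
    rq = remQuot {suc (k P)} (suc (k Q))
    e : Fin (M + n) → Fin M → ℚ
    e i c = ℤtoℚ (lookup (v P (proj₁ (rq (F i)))) c)
    -- The coordinate `nothing` is constantly 1: a linear relation in it says that the weights sum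
    -- to 0, which turns affine into linear independence.
    u : Fin (M + n) → Maybe (Fin N) → ℚ
    u i nothing  = 1ℚ
    u i (just c) = ℤtoℚ (lookup (v Q (proj₂ (rq (F i)))) c)
    joint : Indep (λ i → [ e i , u i ]′)
    joint μ rel = indep μ (trans (sym (Σℚ-*1 μ)) (rel (inj₂ nothing)))
      (λ c → subst (λ c → Σℚ (λ i → μ i ℚ.* ℤtoℚ (lookup (v (P ⊗ Q) (F i)) c)) ≡ 0ℚ)
        (Finₚ.join-splitAt M N c) (coord (splitAt M c)))
      where
      coord : ∀ s → Σℚ (λ i → μ i ℚ.* ℤtoℚ (lookup (v (P ⊗ Q) (F i)) (join M N s))) ≡ 0ℚ
      coord (inj₁ c) = trans (Σℚ-cong (λ i → cong (λ z → μ i ℚ.* ℤtoℚ z)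
        (Vecₚ.lookup-++ˡ (v P (proj₁ (rq (F i)))) (v Q (proj₂ (rq (F i)))) c))) (rel (inj₁ c))
      coord (inj₂ c) = trans (Σℚ-cong (λ i → cong (λ z → μ i ℚ.* ℤtoℚ z)
        (Vecₚ.lookup-++ʳ (v P (proj₁ (rq (F i)))) (v Q (proj₂ (rq (F i)))) c))) (rel (inj₂ (just c)))

  -- One row and one column of the grid of pairs, through the corner `(f zero , g zero)`. The corner
  -- is counted once, in the second part, which gives `a + suc b` vertices.
  cross : ∀ {a b} → (Fin (suc a) → Fin (suc (k P))) → (Fin (suc b) → Fin (suc (k Q))) →
    Fin (a + suc b) → Fin (suc (k (P ⊗ Q)))
  cross {a} f g = [ (λ i → pair P Q (f (suc i)) (g zero)) , (λ j → pair P Q (f zero) (g j)) ]′ ∘ splitAt a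

  -- Projected to `P`, all vertices of the second part collapse to `f zero`, so the relation becomes
  -- one on `f` with weight `Σℚ β` there. Independence of `f` kills `α` and also gives `Σℚ β ≡ 0ℚ`,
  -- which is precisely the affine condition needed to apply independence of `g` to `β`.
  AffIndep-⊗ : ∀ {a b} (f : Fin (suc a) → Fin (suc (k P))) (g : Fin (suc b) → Fin (suc (k Q))) →
    AffIndep P f → AffIndep Q g → AffIndep (P ⊗ Q) (cross f g)
  AffIndep-⊗ {a} {b} f g f-indep g-indep μ Σμ≡0 coord i =
    trans (cong μ (sym (Finₚ.join-splitAt a (suc b) i))) (vanish (splitAt a i))
    where
    open ≡-Reasoning
    α : Fin a → ℚ
    α i = μ (i ↑ˡ suc b)
    β : Fin (suc b) → ℚ
    β j = μ (a ↑ʳ j)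
    left : Fin a → Fin (suc (k (P ⊗ Q)))
    left i = pair P Q (f (suc i)) (g zero)
    right : Fin (suc b) → Fin (suc (k (P ⊗ Q)))
    right j = pair P Q (f zero) (g j)
    Σcross : (φ : Fin (suc (k (P ⊗ Q))) → ℚ) → Σℚ (λ i → μ i ℚ.* φ (cross f g i))
      ≡ Σℚ (λ i → α i ℚ.* φ (pair P Q (f (suc i)) (g zero))) ℚ.+ Σℚ (λ j → β j ℚ.* φ (pair P Q (f zero) (g j)))
    Σcross φ = trans (Σℚ-++ a (λ i → μ i ℚ.* φ (cross f g i))) (cong₂ ℚ._+_
      (Σℚ-cong (λ i → cong (λ s → α i ℚ.* φ ([ left , right ]′ s)) (Finₚ.splitAt-↑ˡ a i (suc b))))
      (Σℚ-cong (λ j → cong (λ s → β j ℚ.* φ ([ left , right ]′ s)) (Finₚ.splitAt-↑ʳ a (suc b) j))))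
    γ : Fin (suc a) → ℚ
    γ zero    = Σℚ β
    γ (suc i) = α i
    γ-coord : ∀ c → Σℚ (λ i → γ i ℚ.* ℤtoℚ (lookup (v P (f i)) c)) ≡ 0ℚ
    γ-coord c = begin
      Σℚ β ℚ.* x (f zero) ℚ.+ Σℚ (λ i → α i ℚ.* x (f (suc i)))
        ≡⟨ ℚₚ.+-comm (Σℚ β ℚ.* x (f zero)) _ ⟩
      Σℚ (λ i → α i ℚ.* x (f (suc i))) ℚ.+ Σℚ β ℚ.* x (f zero)
        ≡⟨ cong (Σℚ (λ i → α i ℚ.* x (f (suc i))) ℚ.+_) (Σℚ-*ʳ β (x (f zero))) ⟨
      Σℚ (λ i → α i ℚ.* x (f (suc i))) ℚ.+ Σℚ (λ j → β j ℚ.* x (f zero))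
        ≡⟨ cong₂ ℚ._+_
             (Σℚ-cong (λ i → cong (λ z → α i ℚ.* ℤtoℚ z) (lookup-v-pairˡ P Q (f (suc i)) (g zero) c)))
             (Σℚ-cong (λ j → cong (λ z → β j ℚ.* ℤtoℚ z) (lookup-v-pairˡ P Q (f zero) (g j) c))) ⟨
      _ ≡⟨ Σcross (λ p → ℤtoℚ (lookup (v (P ⊗ Q) p) (c ↑ˡ N))) ⟨
      _ ≡⟨ coord (c ↑ˡ N) ⟩
      0ℚ ∎
      where
      x : Fin (suc (k P)) → ℚ
      x p = ℤtoℚ (lookup (v P p) c)
    γ≡0 : ∀ i → γ i ≡ 0ℚ
    γ≡0 = f-indep γ (trans (ℚₚ.+-comm (Σℚ β) (Σℚ α)) (trans (sym (Σℚ-++ a μ)) Σμ≡0)) γ-coord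
    β-coord : ∀ c → Σℚ (λ j → β j ℚ.* ℤtoℚ (lookup (v Q (g j)) c)) ≡ 0ℚ
    β-coord c = begin
      Σℚ (λ j → β j ℚ.* ℤtoℚ (lookup (v Q (g j)) c))
        ≡⟨ Σℚ-cong (λ j → cong (λ z → β j ℚ.* ℤtoℚ z) (lookup-v-pairʳ P Q (f zero) (g j) c)) ⟨
      Σℚ (λ j → β j ℚ.* φ (pair P Q (f zero) (g j)))
        ≡⟨ ℚₚ.+-identityˡ _ ⟨
      0ℚ ℚ.+ Σℚ (λ j → β j ℚ.* φ (pair P Q (f zero) (g j)))
        ≡⟨ cong (ℚ._+ Σℚ (λ j → β j ℚ.* φ (right j))) (Σℚ-zero (λ i → trans (cong (ℚ._* φ (pair P Q (f (suc i)) (g zero))) (γ≡0 (suc i)))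
             (ℚₚ.*-zeroˡ (φ (pair P Q (f (suc i)) (g zero)))))) ⟨
      _ ≡⟨ Σcross φ ⟨
      _ ≡⟨ coord (M ↑ʳ c) ⟩
      0ℚ ∎
      where
      φ : Fin (suc (k (P ⊗ Q))) → ℚ
      φ p = ℤtoℚ (lookup (v (P ⊗ Q) p) (M ↑ʳ c))
    vanish : ∀ s → μ (join a (suc b) s) ≡ 0ℚ
    vanish (inj₁ i) = γ≡0 (suc i)
    vanish (inj₂ j) = g-indep β (γ≡0 zero) β-coord j

-- The embedding of ℤ in ℚ

private
  -- `z / 1` is normalised by a gcd that does not reduce for a variable `z`. As an unnormalised
  -- fraction the same number is a constructor form with denominator 1, on which the laws below
  -- become integer identities.
  ℤtoℚᵘ : ℤ → ℚᵘ.ℚᵘ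
  ℤtoℚᵘ z = ℚᵘ.mkℚᵘ z 0

  toℚᵘ-ℤtoℚ : ∀ z → ℚ.toℚᵘ (ℤtoℚ z) ℚᵘ.≃ ℤtoℚᵘ z
  toℚᵘ-ℤtoℚ z = ℚₚ.toℚᵘ-fromℚᵘ (ℤtoℚᵘ z)

ℤtoℚ-+ : ∀ x y → ℤtoℚ (x ℤ.+ y) ≡ ℤtoℚ x ℚ.+ ℤtoℚ y
ℤtoℚ-+ x y = ℚₚ.toℚᵘ-injective (begin
  ℚ.toℚᵘ (ℤtoℚ (x ℤ.+ y))                ≈⟨ toℚᵘ-ℤtoℚ (x ℤ.+ y) ⟩
  ℤtoℚᵘ (x ℤ.+ y)                        ≈⟨ ℚᵘ.*≡* (cong (ℤ._* + 1) (cong₂ ℤ._+_ (ℤₚ.*-identityʳ x) (ℤₚ.*-identityʳ y))) ⟨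
  ℤtoℚᵘ x ℚᵘ.+ ℤtoℚᵘ y                   ≈⟨ ℚᵘₚ.+-cong (toℚᵘ-ℤtoℚ x) (toℚᵘ-ℤtoℚ y) ⟨
  ℚ.toℚᵘ (ℤtoℚ x) ℚᵘ.+ ℚ.toℚᵘ (ℤtoℚ y)   ≈⟨ ℚₚ.toℚᵘ-homo-+ (ℤtoℚ x) (ℤtoℚ y) ⟨
  ℚ.toℚᵘ (ℤtoℚ x ℚ.+ ℤtoℚ y)             ∎)
  where open ℚᵘₚ.≃-Reasoning

ℤtoℚ-* : ∀ x y → ℤtoℚ (x ℤ.* y) ≡ ℤtoℚ x ℚ.* ℤtoℚ y
ℤtoℚ-* x y = ℚₚ.toℚᵘ-injective (begin
  ℚ.toℚᵘ (ℤtoℚ (x ℤ.* y))                ≈⟨ toℚᵘ-ℤtoℚ (x ℤ.* y) ⟩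
  ℤtoℚᵘ x ℚᵘ.* ℤtoℚᵘ y                   ≈⟨ ℚᵘₚ.*-cong (toℚᵘ-ℤtoℚ x) (toℚᵘ-ℤtoℚ y) ⟨
  ℚ.toℚᵘ (ℤtoℚ x) ℚᵘ.* ℚ.toℚᵘ (ℤtoℚ y)   ≈⟨ ℚₚ.toℚᵘ-homo-* (ℤtoℚ x) (ℤtoℚ y) ⟨
  ℚ.toℚᵘ (ℤtoℚ x ℚ.* ℤtoℚ y)             ∎)
  where open ℚᵘₚ.≃-Reasoning

ℤtoℚ-neg : ∀ x → ℤtoℚ (ℤ.- x) ≡ ℚ.- ℤtoℚ x
ℤtoℚ-neg x = ℚₚ.toℚᵘ-injective (begin
  ℚ.toℚᵘ (ℤtoℚ (ℤ.- x))   ≈⟨ toℚᵘ-ℤtoℚ (ℤ.- x) ⟩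
  ℚᵘ.- ℤtoℚᵘ x            ≈⟨ ℚᵘₚ.-‿cong (toℚᵘ-ℤtoℚ x) ⟨
  ℚᵘ.- ℚ.toℚᵘ (ℤtoℚ x)    ≈⟨ ℚₚ.toℚᵘ-homo‿- (ℤtoℚ x) ⟨
  ℚ.toℚᵘ (ℚ.- ℤtoℚ x)     ∎)
  where open ℚᵘₚ.≃-Reasoning

ℤtoℚ-injective : ∀ {x y} → ℤtoℚ x ≡ ℤtoℚ y → x ≡ y
ℤtoℚ-injective {x} {y} eq with ℚₚ.fromℚᵘ-injective {ℤtoℚᵘ x} {ℤtoℚᵘ y} eq
... | ℚᵘ.*≡* x*1≡y*1 = trans (sym (ℤₚ.*-identityʳ x)) (trans x*1≡y*1 (ℤₚ.*-identityʳ y))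

ℤtoℚ-mono-≤ : ∀ {x y} → x ℤ.≤ y → ℤtoℚ x ℚ.≤ ℤtoℚ y
ℤtoℚ-mono-≤ {x} {y} x≤y = ℚₚ.toℚᵘ-cancel-≤
  (ℚᵘₚ.≤-respˡ-≃ (ℚᵘₚ.≃-sym (toℚᵘ-ℤtoℚ x)) (ℚᵘₚ.≤-respʳ-≃ (ℚᵘₚ.≃-sym (toℚᵘ-ℤtoℚ y))
    (ℚᵘ.*≤* (ℤₚ.*-monoʳ-≤-nonNeg (+ 1) x≤y))))

ℤtoℚ-cancel-≤ : ∀ {x y} → ℤtoℚ x ℚ.≤ ℤtoℚ y → x ℤ.≤ y
ℤtoℚ-cancel-≤ {x} {y} x≤y = ℤₚ.≮⇒≥ λ y<x → ℤₚ.<-irrefl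
  (ℤtoℚ-injective (ℚₚ.≤-antisym (ℤtoℚ-mono-≤ (ℤₚ.<⇒≤ y<x)) x≤y)) y<x

ℕtoℚ-+ : ∀ m n → ℕtoℚ (m + n) ≡ ℕtoℚ m ℚ.+ ℕtoℚ n
ℕtoℚ-+ m n = ℤtoℚ-+ (+ m) (+ n)

ℕtoℚ-* : ∀ m n → ℕtoℚ (m ℕ.* n) ≡ ℕtoℚ m ℚ.* ℕtoℚ n
ℕtoℚ-* m n = trans (cong ℤtoℚ (ℤₚ.pos-* m n)) (ℤtoℚ-* (+ m) (+ n))

ℕtoℚ-mono-≤ : ∀ {m n} → m ≤ n → ℕtoℚ m ℚ.≤ ℕtoℚ n
ℕtoℚ-mono-≤ = ℤtoℚ-mono-≤ ∘ ℤ.+≤+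

ℕtoℚ-mono-< : ∀ {m n} → m ℕ.< n → ℕtoℚ m ℚ.< ℕtoℚ n
ℕtoℚ-mono-< m<n = ℚₚ.≰⇒> (λ n≤m → ℕₚ.<⇒≱ m<n (ℤₚ.drop‿+≤+ (ℤtoℚ-cancel-≤ n≤m)))

0≤ℕtoℚ : ∀ n → 0ℚ ℚ.≤ ℕtoℚ n
0≤ℕtoℚ n = ℕtoℚ-mono-≤ {0} {n} ℕ.z≤n

-- Lattice points of a simplex

increment : ∀ {k} → Vec ℕ (suc k) → Vec ℕ (suc k)
increment (a ∷ w) = suc a ∷ w

-- Splitting by whether the first entry is zero makes the lengths obey Pascal's rule, so they are
-- the binomial coefficients of `n + k` over `k`.
simplex : ∀ k → ℕ → List (Vec ℕ k)
simplex zero    n       = [] List.∷ List.[]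
simplex (suc k) zero    = List.map (0 ∷_) (simplex k 0)
simplex (suc k) (suc n) = List.map (0 ∷_) (simplex k (suc n)) List.++ List.map increment (simplex (suc k) n)

∈-simplex⁺ : ∀ {k n} w → Vec.sum w ≤ n → w ∈ simplex k n
∈-simplex⁺ {zero}          []          _        = here refl
∈-simplex⁺ {suc k} {zero}  (zero  ∷ w) w≤n      = ∈ₚ.∈-map⁺ (0 ∷_) (∈-simplex⁺ w w≤n)
∈-simplex⁺ {suc k} {suc n} (zero  ∷ w) w≤n      = ∈ₚ.∈-++⁺ˡ (∈ₚ.∈-map⁺ (0 ∷_) (∈-simplex⁺ w w≤n))
∈-simplex⁺ {suc k} {suc n} (suc a ∷ w) (ℕ.s≤s w≤n) =
  ∈ₚ.∈-++⁺ʳ (List.map (0 ∷_) (simplex k (suc n))) (∈ₚ.∈-map⁺ increment (∈-simplex⁺ (a ∷ w) w≤n))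

∈-simplex⁻ : ∀ {k n w} → w ∈ simplex k n → Vec.sum w ≤ n
∈-simplex⁻ {zero} {n} {[]} _ = ℕ.z≤n
∈-simplex⁻ {suc k} {zero} w∈ with ∈ₚ.∈-map⁻ (0 ∷_) w∈
... | w , w∈′ , refl = ∈-simplex⁻ w∈′
∈-simplex⁻ {suc k} {suc n} w∈ with ∈ₚ.∈-++⁻ (List.map (0 ∷_) (simplex k (suc n))) w∈
... | inj₁ w∈₁ with ∈ₚ.∈-map⁻ (0 ∷_) w∈₁
...   | w , w∈′ , refl = ∈-simplex⁻ w∈′
∈-simplex⁻ {suc k} {suc n} w∈ | inj₂ w∈₂ with ∈ₚ.∈-map⁻ increment w∈₂
...   | (a ∷ w) , w∈′ , refl = ℕ.s≤s (∈-simplex⁻ w∈′)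

simplex-unique : ∀ k n → Unique (simplex k n)
simplex-unique zero    n       = All.[] AllPairs.∷ AllPairs.[]
simplex-unique (suc k) zero    = Uniqueₚ.map⁺ Vecₚ.∷-injectiveʳ (simplex-unique k 0)
simplex-unique (suc k) (suc n) = Uniqueₚ.++⁺
  (Uniqueₚ.map⁺ Vecₚ.∷-injectiveʳ (simplex-unique k (suc n)))
  (Uniqueₚ.map⁺ increment-injective (simplex-unique (suc k) n))
  disjoint
  where
  increment-injective : ∀ {w w′ : Vec ℕ (suc k)} → increment w ≡ increment w′ → w ≡ w′
  increment-injective {_ ∷ _} {_ ∷ _} refl = refl
  disjoint : ∀ {w} → w ∈ List.map (0 ∷_) (simplex k (suc n)) × w ∈ List.map increment (simplex (suc k) n) → ⊥
  disjoint (w∈₁ , w∈₂) with ∈ₚ.∈-map⁻ (0 ∷_) w∈₁ | ∈ₚ.∈-map⁻ increment w∈₂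
  ... | _ , _ , refl | (_ ∷ _) , _ , ()

length-simplex-suc : ∀ k n → length (simplex (suc k) (suc n)) ≡ length (simplex k (suc n)) + length (simplex (suc k) n)
length-simplex-suc k n = trans (Listₚ.length-++ (List.map (0 ∷_) (simplex k (suc n))))
  (cong₂ _+_ (Listₚ.length-map (0 ∷_) (simplex k (suc n))) (Listₚ.length-map increment (simplex (suc k) n)))

length-simplex-1 : ∀ n → length (simplex 1 n) ≡ suc n
length-simplex-1 zero    = refl
length-simplex-1 (suc n) = trans (length-simplex-suc 0 n) (cong suc (length-simplex-1 n))

-- The binomial coefficient of `n + 2` over 2, cleared of its denominator so that the induction
-- stays within semiring identities of ℕ; likewise with 6 in dimension 3.
length-simplex-2 : ∀ n → 2 ℕ.* length (simplex 2 n) ≡ (1 + n) ℕ.* (2 + n)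
length-simplex-2 zero    = refl
length-simplex-2 (suc n) = begin
  2 ℕ.* length (simplex 2 (suc n))               ≡⟨ cong (2 ℕ.*_) (length-simplex-suc 1 n) ⟩
  2 ℕ.* (length (simplex 1 (suc n)) + s)         ≡⟨ cong (λ a → 2 ℕ.* (a + s)) (length-simplex-1 (suc n)) ⟩
  2 ℕ.* (2 + n + s)                              ≡⟨ ℕₚ.*-distribˡ-+ 2 (2 + n) s ⟩
  2 ℕ.* (2 + n) + 2 ℕ.* s                        ≡⟨ cong (λ a → 2 ℕ.* (2 + n) + a) (length-simplex-2 n) ⟩
  2 ℕ.* (2 + n) + (1 + n) ℕ.* (2 + n)            ≡⟨ identity n ⟩
  (2 + n) ℕ.* (3 + n)                            ∎
  where
  open ≡-Reasoning
  s = length (simplex 2 n)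
  identity : ∀ n → 2 ℕ.* (2 + n) + (1 + n) ℕ.* (2 + n) ≡ (2 + n) ℕ.* (3 + n)
  identity = solve-∀

length-simplex-3 : ∀ n → 6 ℕ.* length (simplex 3 n) ≡ (1 + n) ℕ.* (2 + n) ℕ.* (3 + n)
length-simplex-3 zero    = refl
length-simplex-3 (suc n) = begin
  6 ℕ.* length (simplex 3 (suc n))                                 ≡⟨ cong (6 ℕ.*_) (length-simplex-suc 2 n) ⟩
  6 ℕ.* (r + s)                                                    ≡⟨ split r s ⟩
  3 ℕ.* (2 ℕ.* r) + 6 ℕ.* s                                        ≡⟨ cong₂ (λ a b → 3 ℕ.* a + b) (length-simplex-2 (suc n)) (length-simplex-3 n) ⟩
  3 ℕ.* ((2 + n) ℕ.* (3 + n)) + (1 + n) ℕ.* (2 + n) ℕ.* (3 + n)    ≡⟨ identity n ⟩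
  (2 + n) ℕ.* (3 + n) ℕ.* (4 + n)                                  ∎
  where
  open ≡-Reasoning
  r = length (simplex 2 (suc n))
  s = length (simplex 3 n)
  split : ∀ r s → 6 ℕ.* (r + s) ≡ 3 ℕ.* (2 ℕ.* r) + 6 ℕ.* s
  split = solve-∀
  identity : ∀ n → 3 ℕ.* ((2 + n) ℕ.* (3 + n)) + (1 + n) ℕ.* (2 + n) ℕ.* (3 + n) ≡ (2 + n) ℕ.* (3 + n) ℕ.* (4 + n)
  identity = solve-∀

-- Not `simplex 3 (n ∸ 2)`: for `n < 2` truncated subtraction would leave the zero vector, although
-- a point of degree 2 does not fit there.
simplex∸2 : ℕ → List (Vec ℕ 3)
simplex∸2 zero          = List.[]
simplex∸2 (suc zero)    = List.[]
simplex∸2 (suc (suc n)) = simplex 3 n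

-- Six times the binomial coefficient of `n + 1` over 3 is (n - 1) n (n + 1) = n³ - n; the negative
-- term is moved to the left. The empty lists at 0 and 1 agree with this polynomial, so no lower
-- bound on `n` is required.
length-simplex∸2 : ∀ n → 6 ℕ.* length (simplex∸2 n) + n ≡ n ℕ.* n ℕ.* n
length-simplex∸2 zero          = refl
length-simplex∸2 (suc zero)    = refl
length-simplex∸2 (suc (suc n)) = trans (cong (_+ (2 + n)) (length-simplex-3 n)) (identity n)
  where
  identity : ∀ n → (1 + n) ℕ.* (2 + n) ℕ.* (3 + n) + (2 + n) ≡ (2 + n) ℕ.* (2 + n) ℕ.* (2 + n)
  identity = solve-∀

simplex∸2-unique : ∀ n → Unique (simplex∸2 n)
simplex∸2-unique zero          = AllPairs.[]
simplex∸2-unique (suc zero)    = AllPairs.[]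
simplex∸2-unique (suc (suc n)) = simplex-unique 3 n

divMod-injective : ∀ {m r r′} q q′ → r ℕ.< m → r′ ℕ.< m → r + q ℕ.* m ≡ r′ + q′ ℕ.* m → r ≡ r′ × q ≡ q′
divMod-injective {suc m} {r} {r′} q q′ r<m r′<m eq = r≡r′ ,
  ℕₚ.*-cancelʳ-≡ q q′ (suc m) (ℕₚ.+-cancelˡ-≡ r _ _ (trans eq (cong (_+ q′ ℕ.* suc m) (sym r≡r′))))
  where
  remainder : ∀ {r} q → r ℕ.< suc m → (r + q ℕ.* suc m) DivMod.% suc m ≡ r
  remainder {r} q r<m = trans (DivMod.[m+kn]%n≡m%n r q (suc m)) (DivMod.m<n⇒m%n≡m r<m)
  r≡r′ : r ≡ r′
  r≡r′ = trans (sym (remainder q r<m)) (trans (cong (DivMod._% suc m) eq) (remainder q′ r′<m))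

-- Reeve tetrahedra

-- An integer point of n times the Reeve tetrahedron (0,0,0), (1,0,0), (0,1,0), (1,1,m), with m times
-- its weights with respect to the four vertices; these are always integers.
record Bary (m n : ℕ) (x y z : ℤ) : Set where
  constructor bary
  field
    e₀ e₁ e₂ e₃ : ℕ
    sum-eq : e₀ + e₁ + e₂ + e₃ ≡ m ℕ.* n
    x-eq   : + m ℤ.* x ≡ + (e₁ + e₃)
    y-eq   : + m ℤ.* y ≡ + (e₂ + e₃)
    z-eq   : z ≡ + e₃

-- The point (δ, δ, r) plus `q` copies of (1,1,m), `i` of (1,0,0) and `j` of (0,1,0). Copies of the
-- origin are not recorded; they are the slack in the degree.
point : ℕ → ℕ → ℕ → Vec ℕ 3 → Point 3
point m δ r (q ∷ i ∷ j ∷ []) = + (δ + q + i) ∷ + (δ + q + j) ∷ + (r + q ℕ.* m) ∷ []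

-- Division of the third coordinate by `m` recovers `r` and `q`; then `δ` is determined by `r`, and
-- the first two coordinates give `i` and `j`.
point-injective : ∀ {m δ δ′ r r′} w w′ → r ℕ.< m → r′ ℕ.< m → (r ≡ r′ → δ ≡ δ′) →
  point m δ r w ≡ point m δ′ r′ w′ → r ≡ r′ × w ≡ w′
point-injective {m} {δ} (q ∷ i ∷ j ∷ []) (q′ ∷ i′ ∷ j′ ∷ []) r<m r′<m δ≡ eq
  with Vecₚ.∷-injective eq
... | x≡ , eq with Vecₚ.∷-injective eq
... | y≡ , eq with divMod-injective q q′ r<m r′<m (ℤₚ.+-injective (Vecₚ.∷-injectiveˡ eq))
... | refl , refl with δ≡ refl
... | refl = refl , cong₂ (λ i j → q ∷ i ∷ j ∷ [])
  (ℕₚ.+-cancelˡ-≡ (δ + q) i i′ (ℤₚ.+-injective x≡)) (ℕₚ.+-cancelˡ-≡ (δ + q) j j′ (ℤₚ.+-injective y≡))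

-- The half-open fundamental parallelepiped of the cone over the tetrahedron contains, besides the apex,
-- only the points (1,1,r) with 0 < r < m, all of degree 2 (whence simplex∸2); every lattice point of the
-- cone is uniquely one of these plus a natural combination of the vertices.
reevePoints : ℕ → ℕ → List (Point 3)
reevePoints m-1 n = List.map (point (suc m-1) 0 0) (simplex 3 n) List.++
  cartesianProductWith (λ r → point (suc m-1) 1 (suc (toℕ r))) (List.allFin m-1) (simplex∸2 n)

length-reevePoints : ∀ m-1 n → length (reevePoints m-1 n) ≡ length (simplex 3 n) + m-1 ℕ.* length (simplex∸2 n)
length-reevePoints m-1 n = trans (Listₚ.length-++ (List.map (point (suc m-1) 0 0) (simplex 3 n)))
  (cong₂ _+_ (Listₚ.length-map (point (suc m-1) 0 0) (simplex 3 n))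
    (trans (length-cartesianProductWith _ (List.allFin m-1) (simplex∸2 n))
      (cong (ℕ._* length (simplex∸2 n)) (Listₚ.length-tabulate {n = m-1} id))))

reevePoints-unique : ∀ m-1 n → Unique (reevePoints m-1 n)
reevePoints-unique m-1 n = Uniqueₚ.++⁺
  (Uniqueₚ.map⁺ (λ {w} {w′} eq → proj₂ (point-injective w w′ ℕ.z<s ℕ.z<s id eq)) (simplex-unique 3 n))
  (Uniqueₚ.cartesianProductWith⁺ _ upper-injective (Uniqueₚ.allFin⁺ m-1) (simplex∸2-unique n))
  disjoint
  where
  upper : Fin m-1 → Vec ℕ 3 → Point 3
  upper r = point (suc m-1) 1 (suc (toℕ r))
  upper-injective : ∀ {r r′ : Fin m-1} {w w′} → upper r w ≡ upper r′ w′ → r ≡ r′ × w ≡ w′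
  upper-injective {r} {r′} {w} {w′} eq
    with point-injective w w′ (ℕ.s<s (Finₚ.toℕ<n r)) (ℕ.s<s (Finₚ.toℕ<n r′)) (λ _ → refl) eq
  ... | r≡ , w≡ = Finₚ.toℕ-injective (ℕₚ.suc-injective r≡) , w≡
  disjoint : ∀ {x} → x ∈ List.map (point (suc m-1) 0 0) (simplex 3 n) ×
    x ∈ cartesianProductWith upper (List.allFin m-1) (simplex∸2 n) → ⊥
  disjoint (x∈₁ , x∈₂) with ∈ₚ.∈-map⁻ (point (suc m-1) 0 0) x∈₁
    | ∈ₚ.∈-cartesianProductWith⁻ upper (List.allFin m-1) (simplex∸2 n) x∈₂
  ... | w , _ , refl | r , w′ , _ , _ , eq
    with point-injective w w′ ℕ.z<s (ℕ.s<s (Finₚ.toℕ<n r)) (λ ()) eq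
  ... | () , _

+*+ : ∀ m a b c → m ℕ.* a ≡ b + c → + m ℤ.* + a ≡ + (b + c)
+*+ m a b c eq = trans (sym (ℤₚ.pos-* m a)) (cong +_ eq)

∈-reevePoints⁻ : ∀ {m-1 n x y z} → (x ∷ y ∷ z ∷ []) ∈ reevePoints m-1 n → Bary (suc m-1) n x y z
∈-reevePoints⁻ {m-1} {n} x∈ with ∈ₚ.∈-++⁻ (List.map (point (suc m-1) 0 0) (simplex 3 n)) x∈
... | inj₁ x∈₁ with ∈ₚ.∈-map⁻ (point (suc m-1) 0 0) x∈₁
...   | (q ∷ i ∷ j ∷ []) , w∈ , refl with ℕₚ.m≤n⇒∃[o]m+o≡n (∈-simplex⁻ {3} {n} w∈)
-- The slack `h` is the multiplicity of the origin; each scaled weight is `m` times a multiplicity.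
...     | h , refl = bary (m ℕ.* h) (m ℕ.* i) (m ℕ.* j) (q ℕ.* m) (total m h i j q)
  (+*+ m (q + i) (m ℕ.* i) (q ℕ.* m) (first m q i)) (+*+ m (q + j) (m ℕ.* j) (q ℕ.* m) (first m q j)) refl
  where
  m = suc m-1
  total : ∀ m h i j q → m ℕ.* h + m ℕ.* i + m ℕ.* j + q ℕ.* m ≡ m ℕ.* (q + (i + (j + 0)) + h)
  total = solve-∀
  first : ∀ m q i → m ℕ.* (q + i) ≡ m ℕ.* i + q ℕ.* m
  first = solve-∀
∈-reevePoints⁻ {m-1} {n} x∈ | inj₂ x∈₂
  with ∈ₚ.∈-cartesianProductWith⁻ (λ r → point (suc m-1) 1 (suc (toℕ r))) (List.allFin m-1) (simplex∸2 n) x∈₂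
∈-reevePoints⁻ {m-1} {suc (suc n)} x∈ | inj₂ _ | r , (q ∷ i ∷ j ∷ []) , _ , w∈ , refl
  with ℕₚ.m≤n⇒∃[o]m+o≡n (∈-simplex⁻ {3} {n} w∈) | ℕₚ.m≤n⇒∃[o]m+o≡n (Finₚ.toℕ<n r)
-- The point (1, 1, r) has weights r/m, (m - r)/m, (m - r)/m, r/m. Writing `m` as `suc (r′ + s)`
-- turns m - r into `suc s` and avoids subtraction.
... | h , refl | s , r+s≡m = subst (λ m → Bary (suc m) _ _ _ (+ (r′ + q ℕ.* suc m))) r+s≡m
  (bary (m ℕ.* h + r′) (m ℕ.* i + suc s) (m ℕ.* j + suc s) (r′ + q ℕ.* m) (total r′ s h i j q)
    (+*+ m (suc (q + i)) (m ℕ.* i + suc s) (r′ + q ℕ.* m) (first r′ s q i))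
    (+*+ m (suc (q + j)) (m ℕ.* j + suc s) (r′ + q ℕ.* m) (first r′ s q j)) refl)
  where
  r′ = suc (toℕ r)
  m = suc (r′ + s)
  total : ∀ r s h i j q → let m = suc (r + s) in
    (m ℕ.* h + r) + (m ℕ.* i + suc s) + (m ℕ.* j + suc s) + (r + q ℕ.* m) ≡ m ℕ.* suc (suc (q + (i + (j + 0)) + h))
  total = solve-∀
  first : ∀ r s q i → let m = suc (r + s) in m ℕ.* suc (q + i) ≡ m ℕ.* i + suc s + (r + q ℕ.* m)
  first = solve-∀

-- The height `z` equals `e₃`, so division of `e₃` by `m` yields the multiplicity `q` of the top
-- vertex, and the remainder selects the point of the parallelepiped. A negative `x` or `y` is
-- impossible, since its multiple by `m` is a natural number.
∈-reevePoints⁺ : ∀ {m-1 n x y z} → Bary (suc m-1) n x y z → (x ∷ y ∷ z ∷ []) ∈ reevePoints m-1 n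
∈-reevePoints⁺ {m-1} {n} {+ x} {+ y} (bary e₀ e₁ e₂ e₃ sum-eq x-eq y-eq refl) =
  locate (e₃ DivMod.% m) (e₃ DivMod./ m) (DivMod.m%n<n e₃ m) (DivMod.m≡m%n+[m/n]*n e₃ m)
  where
  m = suc m-1
  mx : m ℕ.* x ≡ e₁ + e₃
  mx = ℤₚ.+-injective (trans (ℤₚ.pos-* m x) x-eq)
  my : m ℕ.* y ≡ e₂ + e₃
  my = ℤₚ.+-injective (trans (ℤₚ.pos-* m y) y-eq)
  -- With `e₁` and `e₂` eliminated, m (x + y) - e₃ = m n - e₀ ≤ m n. This is what bounds the degree
  -- in both cases.
  balance : m ℕ.* n + e₃ ≡ e₀ + m ℕ.* (x + y)
  balance = begin
    m ℕ.* n + e₃                  ≡⟨ cong (_+ e₃) sum-eq ⟨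
    e₀ + e₁ + e₂ + e₃ + e₃        ≡⟨ shuffle e₀ e₁ e₂ e₃ ⟩
    e₀ + ((e₁ + e₃) + (e₂ + e₃))  ≡⟨ cong (λ a → e₀ + a) (cong₂ _+_ mx my) ⟨
    e₀ + (m ℕ.* x + m ℕ.* y)      ≡⟨ cong (λ a → e₀ + a) (ℕₚ.*-distribˡ-+ m x y) ⟨
    e₀ + m ℕ.* (x + y)            ∎
    where
    open ≡-Reasoning
    shuffle : ∀ a b c d → a + b + c + d + d ≡ a + ((b + d) + (c + d))
    shuffle = solve-∀
  m*q≤m*x : ∀ {r q e x} → e₃ ≡ r + q ℕ.* m → m ℕ.* x ≡ e + e₃ → r + m ℕ.* q ≤ m ℕ.* x
  m*q≤m*x {r} {q} {e} {x} refl eq = begin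
    r + m ℕ.* q       ≡⟨ cong (λ a → r + a) (ℕₚ.*-comm m q) ⟩
    r + q ℕ.* m       ≤⟨ ℕₚ.m≤n+m _ e ⟩
    e + (r + q ℕ.* m) ≡⟨ eq ⟨
    m ℕ.* x           ∎
    where open ℕₚ.≤-Reasoning
  locate : ∀ r q → r ℕ.< m → e₃ ≡ r + q ℕ.* m → (+ x ∷ + y ∷ + e₃ ∷ []) ∈ reevePoints m-1 n
  locate zero q r<m e₃≡
    with ℕₚ.m≤n⇒∃[o]m+o≡n (ℕₚ.*-cancelˡ-≤ {q} {x} m (m*q≤m*x {0} {q} e₃≡ mx))
       | ℕₚ.m≤n⇒∃[o]m+o≡n (ℕₚ.*-cancelˡ-≤ {q} {y} m (m*q≤m*x {0} {q} e₃≡ my))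
  ... | i , refl | j , refl rewrite e₃≡ =
    ∈ₚ.∈-++⁺ˡ (∈ₚ.∈-map⁺ (point m 0 0) (∈-simplex⁺ (q ∷ i ∷ j ∷ []) (ℕₚ.*-cancelˡ-≤ m bound)))
    where
    regroup : ∀ m q i j e → m ℕ.* (q + (i + (j + 0))) + e + q ℕ.* m ≡ e + m ℕ.* (q + i + (q + j))
    regroup = solve-∀
    bound : m ℕ.* (q + (i + (j + 0))) ≤ m ℕ.* n
    bound = ℕₚ.+-cancelʳ-≤ (q ℕ.* m) _ _ (begin
      m ℕ.* (q + (i + (j + 0))) + q ℕ.* m      ≤⟨ ℕₚ.+-monoˡ-≤ (q ℕ.* m) (ℕₚ.m≤m+n _ e₀) ⟩
      m ℕ.* (q + (i + (j + 0))) + e₀ + q ℕ.* m ≡⟨ regroup m q i j e₀ ⟩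
      e₀ + m ℕ.* (q + i + (q + j))             ≡⟨ trans (cong (λ e → m ℕ.* n + e) (sym e₃≡)) balance ⟨
      m ℕ.* n + q ℕ.* m                        ∎)
      where open ℕₚ.≤-Reasoning
  -- A positive remainder makes m q < m x and m q < m y strict, so both coordinates exceed `q`; the
  -- extra unit is the shift δ = 1.
  locate (suc r) q r<m e₃≡
    with ℕₚ.m≤n⇒∃[o]m+o≡n (ℕₚ.*-cancelˡ-< m q x (ℕₚ.≤-trans (ℕₚ.+-monoˡ-≤ (m ℕ.* q) (ℕ.s≤s (ℕ.z≤n {r}))) (m*q≤m*x {suc r} {q} e₃≡ mx)))
       | ℕₚ.m≤n⇒∃[o]m+o≡n (ℕₚ.*-cancelˡ-< m q y (ℕₚ.≤-trans (ℕₚ.+-monoˡ-≤ (m ℕ.* q) (ℕ.s≤s (ℕ.z≤n {r}))) (m*q≤m*x {suc r} {q} e₃≡ my)))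
  ... | i , refl | j , refl rewrite e₃≡ =
    ∈ₚ.∈-++⁺ʳ (List.map (point m 0 0) (simplex 3 n))
      (subst (λ r → (+ suc (q + i) ∷ + suc (q + j) ∷ + (suc r + q ℕ.* m) ∷ []) ∈
                cartesianProductWith (λ r → point m 1 (suc (toℕ r))) (List.allFin m-1) (simplex∸2 n))
        (Finₚ.toℕ-fromℕ< r<m-1)
        (∈ₚ.∈-cartesianProductWith⁺ (λ r → point m 1 (suc (toℕ r))) (∈ₚ.∈-allFin (fromℕ< r<m-1)) (∈-simplex∸2 n bound)))
    where
    r<m-1 : r ℕ.< m-1
    r<m-1 = ℕ.s<s⁻¹ r<m
    regroup : ∀ m q i j e → m ℕ.* suc (suc (q + (i + (j + 0)))) + e + q ℕ.* m ≡ e + m ℕ.* (suc (q + i) + suc (q + j))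
    regroup = solve-∀
    reassoc : ∀ m n r a → m ℕ.* n + (r + a) ≡ r + m ℕ.* n + a
    reassoc = solve-∀
    bound : suc (suc (q + (i + (j + 0)))) ≤ n
    -- Here `balance` overshoots m n by the remainder `suc r`. As this is less than `m`, the degree
    -- is strictly below `suc n`, hence at most `n`.
    bound = ℕ.s≤s⁻¹ (ℕₚ.*-cancelˡ-< m _ (suc n) (ℕₚ.+-cancelʳ-< (q ℕ.* m) _ _ (begin-strict
      m ℕ.* suc (suc (q + (i + (j + 0)))) + q ℕ.* m      ≤⟨ ℕₚ.+-monoˡ-≤ (q ℕ.* m) (ℕₚ.m≤m+n _ e₀) ⟩
      m ℕ.* suc (suc (q + (i + (j + 0)))) + e₀ + q ℕ.* m ≡⟨ regroup m q i j e₀ ⟩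
      e₀ + m ℕ.* (suc (q + i) + suc (q + j))             ≡⟨ trans (cong (λ e → m ℕ.* n + e) (sym e₃≡)) balance ⟨
      m ℕ.* n + (suc r + q ℕ.* m)                        ≡⟨ reassoc m n (suc r) (q ℕ.* m) ⟩
      suc r + m ℕ.* n + q ℕ.* m                          <⟨ ℕₚ.+-monoˡ-< (q ℕ.* m) (ℕₚ.+-monoˡ-< (m ℕ.* n) r<m) ⟩
      m + m ℕ.* n + q ℕ.* m                              ≡⟨ cong (_+ q ℕ.* m) (ℕₚ.*-suc m n) ⟨
      m ℕ.* suc n + q ℕ.* m                              ∎)))
      where open ℕₚ.≤-Reasoning
    ∈-simplex∸2 : ∀ n → suc (suc (q + (i + (j + 0)))) ≤ n → (q ∷ i ∷ j ∷ []) ∈ simplex∸2 n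
    ∈-simplex∸2 (suc (suc n)) (ℕ.s≤s (ℕ.s≤s w≤n)) = ∈-simplex⁺ (q ∷ i ∷ j ∷ []) w≤n
∈-reevePoints⁺ {x = -[1+ _ ]} (bary _ _ _ _ _ () _ _)
∈-reevePoints⁺ {x = + _} {y = -[1+ _ ]} (bary _ _ _ _ _ _ () _)

-- Convex weights in the dilated Reeve tetrahedron

reeve : ℕ → ℕ → IntPolytope 3
reeve l m = poly 3 (lookup ((+ 0 ∷ + 0 ∷ + 0 ∷ []) ∷ (+ l ∷ + 0 ∷ + 0 ∷ []) ∷
  (+ 0 ∷ + l ∷ + 0 ∷ []) ∷ (+ l ∷ + l ∷ + (l ℕ.* m) ∷ []) ∷ []))

integral⇒ℕ : ∀ z {q} → ℤtoℚ z ≡ q → 0ℚ ℚ.≤ q → ∃ λ n → z ≡ + n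
integral⇒ℕ z refl 0≤z = ℤ.∣ z ∣ , sym (ℤₚ.0≤i⇒+∣i∣≡i (ℤtoℚ-cancel-≤ {+ 0} {z} 0≤z))

ℤtoℚ-− : ∀ x y → ℤtoℚ (x ℤ.- y) ≡ ℤtoℚ x ℚ.- ℤtoℚ y
ℤtoℚ-− x y = trans (ℤtoℚ-+ x (ℤ.- y)) (cong (ℤtoℚ x ℚ.+_) (ℤtoℚ-neg y))

module _ (l m : ℕ) .{{_ : ℕ.NonZero l}} .{{_ : ℕ.NonZero m}} where

  private
    L M LM : ℚ
    L = ℕtoℚ l
    M = ℕtoℚ m
    LM = ℕtoℚ (l ℕ.* m)
    LM≡L*M : LM ≡ L ℚ.* M
    LM≡L*M = ℕtoℚ-* l m
    0≤ML : 0ℚ ℚ.≤ M ℚ.* L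
    0≤ML = 0≤p*q (0≤ℕtoℚ m) (0≤ℕtoℚ l)

  -- Scaled by l m, the weights are integer combinations of the data: z for the top vertex, m x - z
  -- and m y - z for the next two, and the rest of m t l for the origin. Being also nonnegative,
  -- they are naturals. The dilation by `l` is absorbed into the degree `t * l`.
  InDilate-reeve⁻ : ∀ t x y z → InDilate t (reeve l m) (x ∷ y ∷ z ∷ []) → Bary m (t ℕ.* l) x y z
  InDilate-reeve⁻ t x y z (λs , λ≥0 , Σλ≡t , coord) = from-naturals
    (integral⇒ℕ E₀ E₀≡ (0≤p*q 0≤ML (λ≥0 zero)))
    (integral⇒ℕ E₁ E₁≡ (0≤p*q 0≤ML (λ≥0 (suc zero))))
    (integral⇒ℕ E₂ E₂≡ (0≤p*q 0≤ML (λ≥0 (suc (suc zero)))))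
    (integral⇒ℕ z E₃≡ (0≤p*q 0≤ML (λ≥0 (suc (suc (suc zero))))))
    where
    open ≡-Reasoning
    open +-*-Solver
    a b c d T : ℚ
    a = λs zero
    b = λs (suc zero)
    c = λs (suc (suc zero))
    d = λs (suc (suc (suc zero)))
    T = ℕtoℚ t
    E₁ E₂ E₀ : ℤ
    E₁ = + m ℤ.* x ℤ.- z
    E₂ = + m ℤ.* y ℤ.- z
    E₀ = + (m ℕ.* (t ℕ.* l)) ℤ.- (E₁ ℤ.+ E₂ ℤ.+ z)
    E₃≡ : ℤtoℚ z ≡ M ℚ.* L ℚ.* d
    E₃≡ = begin
      ℤtoℚ z ≡⟨ coord (suc (suc zero)) ⟨
      a ℚ.* 0ℚ ℚ.+ (b ℚ.* 0ℚ ℚ.+ (c ℚ.* 0ℚ ℚ.+ (d ℚ.* LM ℚ.+ 0ℚ)))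
        ≡⟨ cong (λ w → a ℚ.* 0ℚ ℚ.+ (b ℚ.* 0ℚ ℚ.+ (c ℚ.* 0ℚ ℚ.+ (d ℚ.* w ℚ.+ 0ℚ)))) LM≡L*M ⟩
      a ℚ.* 0ℚ ℚ.+ (b ℚ.* 0ℚ ℚ.+ (c ℚ.* 0ℚ ℚ.+ (d ℚ.* (L ℚ.* M) ℚ.+ 0ℚ)))
        ≡⟨ solve 6 (λ a b c d L M → a :* con 0ℚ :+ (b :* con 0ℚ :+ (c :* con 0ℚ :+ (d :* (L :* M) :+ con 0ℚ))) := M :* L :* d)
             refl a b c d L M ⟩
      M ℚ.* L ℚ.* d ∎
    E₁≡ : ℤtoℚ E₁ ≡ M ℚ.* L ℚ.* b
    E₁≡ = begin
      ℤtoℚ E₁                             ≡⟨ ℤtoℚ-− (+ m ℤ.* x) z ⟩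
      ℤtoℚ (+ m ℤ.* x) ℚ.- ℤtoℚ z         ≡⟨ cong₂ ℚ._-_ (ℤtoℚ-* (+ m) x) E₃≡ ⟩
      M ℚ.* ℤtoℚ x ℚ.- M ℚ.* L ℚ.* d      ≡⟨ cong (λ w → M ℚ.* w ℚ.- M ℚ.* L ℚ.* d) (coord zero) ⟨
      M ℚ.* (a ℚ.* 0ℚ ℚ.+ (b ℚ.* L ℚ.+ (c ℚ.* 0ℚ ℚ.+ (d ℚ.* L ℚ.+ 0ℚ)))) ℚ.- M ℚ.* L ℚ.* d
        ≡⟨ solve 6 (λ a b c d L M → M :* (a :* con 0ℚ :+ (b :* L :+ (c :* con 0ℚ :+ (d :* L :+ con 0ℚ)))) :- M :* L :* d := M :* L :* b)
             refl a b c d L M ⟩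
      M ℚ.* L ℚ.* b ∎
    E₂≡ : ℤtoℚ E₂ ≡ M ℚ.* L ℚ.* c
    E₂≡ = begin
      ℤtoℚ E₂                             ≡⟨ ℤtoℚ-− (+ m ℤ.* y) z ⟩
      ℤtoℚ (+ m ℤ.* y) ℚ.- ℤtoℚ z         ≡⟨ cong₂ ℚ._-_ (ℤtoℚ-* (+ m) y) E₃≡ ⟩
      M ℚ.* ℤtoℚ y ℚ.- M ℚ.* L ℚ.* d      ≡⟨ cong (λ w → M ℚ.* w ℚ.- M ℚ.* L ℚ.* d) (coord (suc zero)) ⟨
      M ℚ.* (a ℚ.* 0ℚ ℚ.+ (b ℚ.* 0ℚ ℚ.+ (c ℚ.* L ℚ.+ (d ℚ.* L ℚ.+ 0ℚ)))) ℚ.- M ℚ.* L ℚ.* d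
        ≡⟨ solve 6 (λ a b c d L M → M :* (a :* con 0ℚ :+ (b :* con 0ℚ :+ (c :* L :+ (d :* L :+ con 0ℚ)))) :- M :* L :* d := M :* L :* c)
             refl a b c d L M ⟩
      M ℚ.* L ℚ.* c ∎
    E₀≡ : ℤtoℚ E₀ ≡ M ℚ.* L ℚ.* a
    E₀≡ = begin
      ℤtoℚ E₀
        ≡⟨ ℤtoℚ-− (+ (m ℕ.* (t ℕ.* l))) (E₁ ℤ.+ E₂ ℤ.+ z) ⟩
      ℕtoℚ (m ℕ.* (t ℕ.* l)) ℚ.- ℤtoℚ (E₁ ℤ.+ E₂ ℤ.+ z)
        ≡⟨ cong₂ ℚ._-_ (trans (ℕtoℚ-* m (t ℕ.* l)) (cong (M ℚ.*_) (ℕtoℚ-* t l)))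
             (trans (ℤtoℚ-+ (E₁ ℤ.+ E₂) z) (cong₂ ℚ._+_ (trans (ℤtoℚ-+ E₁ E₂) (cong₂ ℚ._+_ E₁≡ E₂≡)) E₃≡)) ⟩
      M ℚ.* (T ℚ.* L) ℚ.- (M ℚ.* L ℚ.* b ℚ.+ M ℚ.* L ℚ.* c ℚ.+ M ℚ.* L ℚ.* d)
        ≡⟨ cong (λ w → M ℚ.* (w ℚ.* L) ℚ.- (M ℚ.* L ℚ.* b ℚ.+ M ℚ.* L ℚ.* c ℚ.+ M ℚ.* L ℚ.* d)) Σλ≡t ⟨
      M ℚ.* ((a ℚ.+ (b ℚ.+ (c ℚ.+ (d ℚ.+ 0ℚ)))) ℚ.* L) ℚ.- (M ℚ.* L ℚ.* b ℚ.+ M ℚ.* L ℚ.* c ℚ.+ M ℚ.* L ℚ.* d)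
        ≡⟨ solve 6 (λ a b c d L M → M :* ((a :+ (b :+ (c :+ (d :+ con 0ℚ)))) :* L) :- (M :* L :* b :+ M :* L :* c :+ M :* L :* d) := M :* L :* a)
             refl a b c d L M ⟩
      M ℚ.* L ℚ.* a ∎
    from-naturals : (∃ λ e → E₀ ≡ + e) → (∃ λ e → E₁ ≡ + e) → (∃ λ e → E₂ ≡ + e) → (∃ λ e → z ≡ + e) →
      Bary m (t ℕ.* l) x y z
    from-naturals (e₀ , E₀≡e₀) (e₁ , E₁≡e₁) (e₂ , E₂≡e₂) (e₃ , z≡e₃) = bary e₀ e₁ e₂ e₃
      (ℤₚ.+-injective (begin
        + (e₀ + e₁ + e₂ + e₃)             ≡⟨ reassoc (+ e₀) (+ e₁) (+ e₂) (+ e₃) ⟩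
        + e₀ ℤ.+ (+ e₁ ℤ.+ + e₂ ℤ.+ + e₃) ≡⟨ cong₂ ℤ._+_ E₀≡e₀ (cong₂ ℤ._+_ (cong₂ ℤ._+_ E₁≡e₁ E₂≡e₂) z≡e₃) ⟨
        E₀ ℤ.+ (E₁ ℤ.+ E₂ ℤ.+ z)          ≡⟨ cancel (+ (m ℕ.* (t ℕ.* l))) (E₁ ℤ.+ E₂ ℤ.+ z) ⟩
        + (m ℕ.* (t ℕ.* l))               ∎))
      (trans (sym (cancel (+ m ℤ.* x) z)) (cong₂ ℤ._+_ E₁≡e₁ z≡e₃))
      (trans (sym (cancel (+ m ℤ.* y) z)) (cong₂ ℤ._+_ E₂≡e₂ z≡e₃))
      z≡e₃
      where
      reassoc : ∀ a b c d → a ℤ.+ b ℤ.+ c ℤ.+ d ≡ a ℤ.+ (b ℤ.+ c ℤ.+ d)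
      reassoc a b c d = trans (cong (ℤ._+ d) (ℤₚ.+-assoc a b c)) (ℤₚ.+-assoc a (b ℤ.+ c) d)
      cancel : ∀ a b → a ℤ.- b ℤ.+ b ≡ a
      cancel a b = trans (ℤₚ.+-assoc a (ℤ.- b) b) (trans (cong (λ c → a ℤ.+ c) (ℤₚ.+-inverseˡ b)) (ℤₚ.+-identityʳ a))

  private
    LM≢0 : LM ≢ 0ℚ
    LM≢0 LM≡0 = ℕ.≢-nonZero⁻¹ (l ℕ.* m) {{ℕₚ.m*n≢0 l m}} (ℤₚ.+-injective (ℤtoℚ-injective LM≡0))
    instance
      LM-nonZero : ℚ.NonZero LM
      LM-nonZero = ℚ.≢-nonZero LM≢0

  InDilate-reeve⁺ : ∀ t x y z → Bary m (t ℕ.* l) x y z → InDilate t (reeve l m) (x ∷ y ∷ z ∷ [])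
  InDilate-reeve⁺ t x y z (bary e₀ e₁ e₂ e₃ sum-eq x-eq y-eq z-eq) = λs , λ≥0 , Σλ≡t , coord
    where
    open ≡-Reasoning
    open +-*-Solver
    u T : ℚ
    u = ℚ.1/ LM
    T = ℕtoℚ t
    0≤u : 0ℚ ℚ.≤ u
    0≤u = ℚₚ.<⇒≤ (ℚₚ.positive⁻¹ u {{ℚₚ.1/pos⇒pos LM {{ℚₚ.nonNeg∧nonZero⇒pos LM {{ℚ.nonNegative (0≤ℕtoℚ (l ℕ.* m))}}}}}})
    LMu≡1 : L ℚ.* M ℚ.* u ≡ 1ℚ
    LMu≡1 = trans (cong (ℚ._* u) (sym LM≡L*M)) (ℚₚ.*-inverseʳ LM)
    λs : Fin 4 → ℚ
    λs = lookup ((ℕtoℚ e₀ ℚ.* u) ∷ (ℕtoℚ e₁ ℚ.* u) ∷ (ℕtoℚ e₂ ℚ.* u) ∷ (ℕtoℚ e₃ ℚ.* u) ∷ [])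
    λ≥0 : ∀ j → 0ℚ ℚ.≤ λs j
    λ≥0 zero                   = 0≤p*q (0≤ℕtoℚ e₀) 0≤u
    λ≥0 (suc zero)             = 0≤p*q (0≤ℕtoℚ e₁) 0≤u
    λ≥0 (suc (suc zero))       = 0≤p*q (0≤ℕtoℚ e₂) 0≤u
    λ≥0 (suc (suc (suc zero))) = 0≤p*q (0≤ℕtoℚ e₃) 0≤u
    cancel-LMu : ∀ w {p} → p ≡ w ℚ.* (L ℚ.* M ℚ.* u) → p ≡ w
    cancel-LMu w eq = trans eq (trans (cong (w ℚ.*_) LMu≡1) (ℚₚ.*-identityʳ w))
    A B C D : ℚ
    A = ℕtoℚ e₀
    B = ℕtoℚ e₁
    C = ℕtoℚ e₂
    D = ℕtoℚ e₃
    Σλ≡t : Σℚ λs ≡ T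
    Σλ≡t = cancel-LMu T (begin
      A ℚ.* u ℚ.+ (B ℚ.* u ℚ.+ (C ℚ.* u ℚ.+ (D ℚ.* u ℚ.+ 0ℚ)))
        ≡⟨ solve 5 (λ a b c d u → a :* u :+ (b :* u :+ (c :* u :+ (d :* u :+ con 0ℚ))) := (a :+ b :+ c :+ d) :* u)
             refl A B C D u ⟩
      (A ℚ.+ B ℚ.+ C ℚ.+ D) ℚ.* u
        ≡⟨ cong (ℚ._* u) (trans (ℕtoℚ-+ (e₀ + e₁ + e₂) e₃) (cong (ℚ._+ D)
             (trans (ℕtoℚ-+ (e₀ + e₁) e₂) (cong (ℚ._+ C) (ℕtoℚ-+ e₀ e₁))))) ⟨
      ℕtoℚ (e₀ + e₁ + e₂ + e₃) ℚ.* u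
        ≡⟨ cong (λ w → ℕtoℚ w ℚ.* u) sum-eq ⟩
      ℕtoℚ (m ℕ.* (t ℕ.* l)) ℚ.* u
        ≡⟨ cong (ℚ._* u) (trans (ℕtoℚ-* m (t ℕ.* l)) (cong (M ℚ.*_) (ℕtoℚ-* t l))) ⟩
      M ℚ.* (T ℚ.* L) ℚ.* u
        ≡⟨ solve 4 (λ M T L u → M :* (T :* L) :* u := T :* (L :* M :* u)) refl M T L u ⟩
      T ℚ.* (L ℚ.* M ℚ.* u) ∎)
    horizontal : ∀ w e → + m ℤ.* w ≡ + (e + e₃) → (ℕtoℚ e ℚ.+ D) ℚ.* (u ℚ.* L) ≡ ℤtoℚ w
    horizontal w e eq = cancel-LMu (ℤtoℚ w) (begin
      (ℕtoℚ e ℚ.+ D) ℚ.* (u ℚ.* L)   ≡⟨ cong (ℚ._* (u ℚ.* L)) (ℕtoℚ-+ e e₃) ⟨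
      ℕtoℚ (e + e₃) ℚ.* (u ℚ.* L)    ≡⟨ cong (λ z → ℤtoℚ z ℚ.* (u ℚ.* L)) eq ⟨
      ℤtoℚ (+ m ℤ.* w) ℚ.* (u ℚ.* L) ≡⟨ cong (ℚ._* (u ℚ.* L)) (ℤtoℚ-* (+ m) w) ⟩
      M ℚ.* ℤtoℚ w ℚ.* (u ℚ.* L)
        ≡⟨ solve 4 (λ M W L u → M :* W :* (u :* L) := W :* (L :* M :* u)) refl M (ℤtoℚ w) L u ⟩
      ℤtoℚ w ℚ.* (L ℚ.* M ℚ.* u) ∎)
    coord : ∀ c → Σℚ (λ j → λs j ℚ.* ℤtoℚ (lookup (v (reeve l m) j) c)) ≡ ℤtoℚ (lookup (x ∷ y ∷ z ∷ []) c)
    coord zero = trans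
      (solve 6 (λ a b c d u L → a :* u :* con 0ℚ :+ (b :* u :* L :+ (c :* u :* con 0ℚ :+ (d :* u :* L :+ con 0ℚ))) := (b :+ d) :* (u :* L))
        refl A B C D u L)
      (horizontal x e₁ x-eq)
    coord (suc zero) = trans
      (solve 6 (λ a b c d u L → a :* u :* con 0ℚ :+ (b :* u :* con 0ℚ :+ (c :* u :* L :+ (d :* u :* L :+ con 0ℚ))) := (c :+ d) :* (u :* L))
        refl A B C D u L)
      (horizontal y e₂ y-eq)
    coord (suc (suc zero)) = trans (cancel-LMu D (begin
      A ℚ.* u ℚ.* 0ℚ ℚ.+ (B ℚ.* u ℚ.* 0ℚ ℚ.+ (C ℚ.* u ℚ.* 0ℚ ℚ.+ (D ℚ.* u ℚ.* LM ℚ.+ 0ℚ)))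
        ≡⟨ cong (λ w → A ℚ.* u ℚ.* 0ℚ ℚ.+ (B ℚ.* u ℚ.* 0ℚ ℚ.+ (C ℚ.* u ℚ.* 0ℚ ℚ.+ (D ℚ.* u ℚ.* w ℚ.+ 0ℚ)))) LM≡L*M ⟩
      A ℚ.* u ℚ.* 0ℚ ℚ.+ (B ℚ.* u ℚ.* 0ℚ ℚ.+ (C ℚ.* u ℚ.* 0ℚ ℚ.+ (D ℚ.* u ℚ.* (L ℚ.* M) ℚ.+ 0ℚ)))
        ≡⟨ solve 7 (λ a b c d u L M → a :* u :* con 0ℚ :+ (b :* u :* con 0ℚ :+ (c :* u :* con 0ℚ :+ (d :* u :* (L :* M) :+ con 0ℚ))) := d :* (L :* M :* u))
             refl A B C D u L M ⟩
      D ℚ.* (L ℚ.* M ℚ.* u) ∎)) (cong ℤtoℚ (sym z-eq))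

  -- The three edges at the origin form a triangular matrix, so the weights vanish from the last to the first.
  reeve-AffIndep : AffIndep (reeve l m) id
  reeve-AffIndep μ Σμ≡0 coord = vanish
    where
    open +-*-Solver
    a b c d : ℚ
    a = μ zero
    b = μ (suc zero)
    c = μ (suc (suc zero))
    d = μ (suc (suc (suc zero)))
    L≢0 : L ≢ 0ℚ
    L≢0 L≡0 = ℕ.≢-nonZero⁻¹ l (ℤₚ.+-injective (ℤtoℚ-injective L≡0))
    d≡0 : d ≡ 0ℚ
    d≡0 = p*q≡0∧q≢0⇒p≡0 d LM≢0 (trans
      (solve 5 (λ a b c d w → d :* w := a :* con 0ℚ :+ (b :* con 0ℚ :+ (c :* con 0ℚ :+ (d :* w :+ con 0ℚ)))) refl a b c d LM)
      (coord (suc (suc zero))))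
    c≡0 : c ≡ 0ℚ
    c≡0 = p*q≡0∧q≢0⇒p≡0 c L≢0 (trans
      (solve 4 (λ a b c w → c :* w := a :* con 0ℚ :+ (b :* con 0ℚ :+ (c :* w :+ (con 0ℚ :* w :+ con 0ℚ)))) refl a b c L)
      (subst (λ d → a ℚ.* 0ℚ ℚ.+ (b ℚ.* 0ℚ ℚ.+ (c ℚ.* L ℚ.+ (d ℚ.* L ℚ.+ 0ℚ))) ≡ 0ℚ) d≡0 (coord (suc zero))))
    b≡0 : b ≡ 0ℚ
    b≡0 = p*q≡0∧q≢0⇒p≡0 b L≢0 (trans
      (solve 4 (λ a b c w → b :* w := a :* con 0ℚ :+ (b :* w :+ (c :* con 0ℚ :+ (con 0ℚ :* w :+ con 0ℚ)))) refl a b c L)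
      (subst (λ d → a ℚ.* 0ℚ ℚ.+ (b ℚ.* L ℚ.+ (c ℚ.* 0ℚ ℚ.+ (d ℚ.* L ℚ.+ 0ℚ))) ≡ 0ℚ) d≡0 (coord zero)))
    a≡0 : a ≡ 0ℚ
    a≡0 = begin
      a                                       ≡⟨ ℚₚ.+-identityʳ a ⟨
      a ℚ.+ (0ℚ ℚ.+ (0ℚ ℚ.+ (0ℚ ℚ.+ 0ℚ)))     ≡⟨ cong (a ℚ.+_) (cong₂ ℚ._+_ b≡0 (cong₂ ℚ._+_ c≡0 (cong (ℚ._+ 0ℚ) d≡0))) ⟨
      a ℚ.+ (b ℚ.+ (c ℚ.+ (d ℚ.+ 0ℚ)))        ≡⟨ Σμ≡0 ⟩
      0ℚ                                      ∎
      where open ≡-Reasoning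
    vanish : ∀ i → μ i ≡ 0ℚ
    vanish zero                   = a≡0
    vanish (suc zero)             = b≡0
    vanish (suc (suc zero))       = c≡0
    vanish (suc (suc (suc zero))) = d≡0

Enumerates-reeve : ∀ l m-1 .{{_ : ℕ.NonZero l}} t → Enumerates t (reeve l (suc m-1)) (reevePoints m-1 (t ℕ.* l))
Enumerates-reeve l m-1 t = reevePoints-unique m-1 (t ℕ.* l) , λ { (x ∷ y ∷ z ∷ []) → mk⇔
  (InDilate-reeve⁺ l (suc m-1) t x y z ∘ ∈-reevePoints⁻) (∈-reevePoints⁺ ∘ InDilate-reeve⁻ l (suc m-1) t x y z) }

-- Here m - 1 = 6 s + 11. Its 11 cancels the 11 n in (n + 1)(n + 2)(n + 3) = n³ + 6 n² + 11 n + 6,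
-- so that division by 6 leaves natural coefficients and the single negative term -s n, which is
-- moved to the left.
length-reevePoints-6 : ∀ s n →
  length (reevePoints (6 ℕ.* s + 11) n) + s ℕ.* n ≡ (2 + s) ℕ.* (n ℕ.* n ℕ.* n) + n ℕ.* n + 1
-- Adding 11 n completes 6 s n to (6 s + 11) n, one `n` for each copy of `simplex∸2 n`, as
-- `length-simplex∸2` demands.
length-reevePoints-6 s n = ℕₚ.*-cancelˡ-≡ _ _ 6 (ℕₚ.+-cancelʳ-≡ (11 ℕ.* n) _ _ (begin
  6 ℕ.* (length (reevePoints (6 ℕ.* s + 11) n) + s ℕ.* n) + 11 ℕ.* n
    ≡⟨ cong (λ a → 6 ℕ.* (a + s ℕ.* n) + 11 ℕ.* n) (length-reevePoints (6 ℕ.* s + 11) n) ⟩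
  6 ℕ.* (p + (6 ℕ.* s + 11) ℕ.* q + s ℕ.* n) + 11 ℕ.* n
    ≡⟨ regroup p q s n ⟩
  6 ℕ.* p + (6 ℕ.* s + 11) ℕ.* (6 ℕ.* q + n)
    ≡⟨ cong₂ (λ a b → a + (6 ℕ.* s + 11) ℕ.* b) (length-simplex-3 n) (length-simplex∸2 n) ⟩
  (1 + n) ℕ.* (2 + n) ℕ.* (3 + n) + (6 ℕ.* s + 11) ℕ.* (n ℕ.* n ℕ.* n)
    ≡⟨ expand s n ⟩
  6 ℕ.* ((2 + s) ℕ.* (n ℕ.* n ℕ.* n) + n ℕ.* n + 1) + 11 ℕ.* n ∎))
  where
  open ≡-Reasoning
  p = length (simplex 3 n)
  q = length (simplex∸2 n)
  regroup : ∀ p q s n → 6 ℕ.* (p + (6 ℕ.* s + 11) ℕ.* q + s ℕ.* n) + 11 ℕ.* n ≡ 6 ℕ.* p + (6 ℕ.* s + 11) ℕ.* (6 ℕ.* q + n)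
  regroup = solve-∀
  expand : ∀ s n → (1 + n) ℕ.* (2 + n) ℕ.* (3 + n) + (6 ℕ.* s + 11) ℕ.* (n ℕ.* n ℕ.* n)
    ≡ 6 ℕ.* ((2 + s) ℕ.* (n ℕ.* n ℕ.* n) + n ℕ.* n + 1) + 11 ℕ.* n
  expand = solve-∀

reeveCoeff : ℕ → ℕ → Fin 3 → ℚ
reeveCoeff l s = lookup ((ℚ.- ℕtoℚ (l ℕ.* s)) ∷ ℕtoℚ (l ℕ.* l) ∷ ℕtoℚ (l ℕ.* l ℕ.* l ℕ.* (2 + s)) ∷ [])

HasEhrhart-reeve : ∀ l s .{{_ : ℕ.NonZero l}} → HasEhrhart (reeve l (suc (6 ℕ.* s + 11))) (reeveCoeff l s)
HasEhrhart-reeve l s t _ = reevePoints (6 ℕ.* s + 11) (t ℕ.* l) , proj₁ lists , proj₂ lists , count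
  where
  open ≡-Reasoning
  open +-*-Solver
  lists = Enumerates-reeve l (6 ℕ.* s + 11) t
  len = length (reevePoints (6 ℕ.* s + 11) (t ℕ.* l))
  a₁ = l ℕ.* s
  a₂ = l ℕ.* l
  a₃ = l ℕ.* l ℕ.* l ℕ.* (2 + s)
  T = ℕtoℚ t
  in-t : len + a₁ ℕ.* t ≡ a₃ ℕ.* (t ℕ.* (t ℕ.* t)) + a₂ ℕ.* (t ℕ.* t) + 1
  in-t = trans (cong (λ a → len + a) (linear l s t)) (trans (length-reevePoints-6 s (t ℕ.* l)) (cubic l s t))
    where
    linear : ∀ l s t → l ℕ.* s ℕ.* t ≡ s ℕ.* (t ℕ.* l)
    linear = solve-∀
    cubic : ∀ l s t → (2 + s) ℕ.* (t ℕ.* l ℕ.* (t ℕ.* l) ℕ.* (t ℕ.* l)) + t ℕ.* l ℕ.* (t ℕ.* l) + 1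
      ≡ l ℕ.* l ℕ.* l ℕ.* (2 + s) ℕ.* (t ℕ.* (t ℕ.* t)) + l ℕ.* l ℕ.* (t ℕ.* t) + 1
    cubic = solve-∀
  in-T : ℕtoℚ len ℚ.+ ℕtoℚ a₁ ℚ.* T ≡ ℕtoℚ a₃ ℚ.* (T ℚ.* (T ℚ.* T)) ℚ.+ ℕtoℚ a₂ ℚ.* (T ℚ.* T) ℚ.+ 1ℚ
  in-T = begin
    ℕtoℚ len ℚ.+ ℕtoℚ a₁ ℚ.* T
      ≡⟨ cong (ℕtoℚ len ℚ.+_) (ℕtoℚ-* a₁ t) ⟨
    ℕtoℚ len ℚ.+ ℕtoℚ (a₁ ℕ.* t)
      ≡⟨ ℕtoℚ-+ len (a₁ ℕ.* t) ⟨
    ℕtoℚ (len + a₁ ℕ.* t)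
      ≡⟨ cong ℕtoℚ in-t ⟩
    ℕtoℚ (a₃ ℕ.* (t ℕ.* (t ℕ.* t)) + a₂ ℕ.* (t ℕ.* t) + 1)
      ≡⟨ ℕtoℚ-+ (a₃ ℕ.* (t ℕ.* (t ℕ.* t)) + a₂ ℕ.* (t ℕ.* t)) 1 ⟩
    ℕtoℚ (a₃ ℕ.* (t ℕ.* (t ℕ.* t)) + a₂ ℕ.* (t ℕ.* t)) ℚ.+ 1ℚ
      ≡⟨ cong (ℚ._+ 1ℚ) (ℕtoℚ-+ (a₃ ℕ.* (t ℕ.* (t ℕ.* t))) (a₂ ℕ.* (t ℕ.* t))) ⟩
    ℕtoℚ (a₃ ℕ.* (t ℕ.* (t ℕ.* t))) ℚ.+ ℕtoℚ (a₂ ℕ.* (t ℕ.* t)) ℚ.+ 1ℚ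
      ≡⟨ cong₂ (λ a b → a ℚ.+ b ℚ.+ 1ℚ)
           (trans (ℕtoℚ-* a₃ (t ℕ.* (t ℕ.* t))) (cong (ℕtoℚ a₃ ℚ.*_) (trans (ℕtoℚ-* t (t ℕ.* t)) (cong (T ℚ.*_) (ℕtoℚ-* t t)))))
           (trans (ℕtoℚ-* a₂ (t ℕ.* t)) (cong (ℕtoℚ a₂ ℚ.*_) (ℕtoℚ-* t t))) ⟩
    ℕtoℚ a₃ ℚ.* (T ℚ.* (T ℚ.* T)) ℚ.+ ℕtoℚ a₂ ℚ.* (T ℚ.* T) ℚ.+ 1ℚ ∎
  count : ℕtoℚ len ≡ EhrPoly (reeveCoeff l s) t
  count = begin
    ℕtoℚ len
      ≡⟨ solve 3 (λ x a T → x := x :+ a :* T :- a :* T) refl (ℕtoℚ len) (ℕtoℚ a₁) T ⟩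
    ℕtoℚ len ℚ.+ ℕtoℚ a₁ ℚ.* T ℚ.- ℕtoℚ a₁ ℚ.* T
      ≡⟨ cong (ℚ._- ℕtoℚ a₁ ℚ.* T) in-T ⟩
    ℕtoℚ a₃ ℚ.* (T ℚ.* (T ℚ.* T)) ℚ.+ ℕtoℚ a₂ ℚ.* (T ℚ.* T) ℚ.+ 1ℚ ℚ.- ℕtoℚ a₁ ℚ.* T
      ≡⟨ solve 4 (λ a₁ a₂ a₃ T → a₃ :* (T :* (T :* T)) :+ a₂ :* (T :* T) :+ con 1ℚ :- a₁ :* T :=
             con 1ℚ :+ ((:- a₁) :* (T :* con 1ℚ) :+ (a₂ :* (T :* (T :* con 1ℚ)) :+ (a₃ :* (T :* (T :* (T :* con 1ℚ))) :+ con 0ℚ))))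
           refl (ℕtoℚ a₁) (ℕtoℚ a₂) (ℕtoℚ a₃) T ⟩
    EhrPoly (reeveCoeff l s) t ∎

-- Coefficient sequences

-- Coefficients are sequences on all of ℕ, so that multiplication by `x` is `shift` without index
-- bounds; `n` only counts the terms that are summed.
eval : ℕ → (ℕ → ℚ) → ℚ → ℚ
eval n f x = Σℚ {n} (λ j → f (toℕ j) ℚ.* (x ^ℚ toℕ j))

shift : (ℕ → ℚ) → ℕ → ℚ
shift f zero    = 0ℚ
shift f (suc i) = f i

eval-shift : ∀ n f x → eval (suc n) (shift f) x ≡ x ℚ.* eval n f x
eval-shift n f x = begin
  0ℚ ℚ.* 1ℚ ℚ.+ Σℚ {n} (λ j → f (toℕ j) ℚ.* (x ℚ.* (x ^ℚ toℕ j)))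
    ≡⟨ ℚₚ.+-identityˡ (Σℚ {n} (λ j → f (toℕ j) ℚ.* (x ℚ.* (x ^ℚ toℕ j)))) ⟩
  Σℚ {n} (λ j → f (toℕ j) ℚ.* (x ℚ.* (x ^ℚ toℕ j)))
    ≡⟨ Σℚ-cong {n} (λ j → rearrange (f (toℕ j)) x (x ^ℚ toℕ j)) ⟩
  Σℚ {n} (λ j → x ℚ.* (f (toℕ j) ℚ.* (x ^ℚ toℕ j)))
    ≡⟨ Σℚ-*ˡ {n} x (λ j → f (toℕ j) ℚ.* (x ^ℚ toℕ j)) ⟩
  x ℚ.* eval n f x ∎
  where
  open ≡-Reasoning
  open +-*-Solver
  rearrange : ∀ a x y → a ℚ.* (x ℚ.* y) ≡ x ℚ.* (a ℚ.* y)
  rearrange = solve 3 (λ a x y → a :* (x :* y) := x :* (a :* y)) refl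

eval-+ : ∀ n f g x → eval n (λ i → f i ℚ.+ g i) x ≡ eval n f x ℚ.+ eval n g x
eval-+ n f g x = trans
  (Σℚ-cong {n} (λ j → ℚₚ.*-distribʳ-+ (x ^ℚ toℕ j) (f (toℕ j)) (g (toℕ j))))
  (Σℚ-+ {n} (λ j → f (toℕ j) ℚ.* (x ^ℚ toℕ j)) (λ j → g (toℕ j) ℚ.* (x ^ℚ toℕ j)))

eval-* : ∀ n q f x → eval n (λ i → q ℚ.* f i) x ≡ q ℚ.* eval n f x
eval-* n q f x = trans
  (Σℚ-cong {n} (λ j → ℚₚ.*-assoc q (f (toℕ j)) (x ^ℚ toℕ j)))
  (Σℚ-*ˡ {n} q (λ j → f (toℕ j) ℚ.* (x ^ℚ toℕ j)))

Σℚ-last : ∀ n (f : ℕ → ℚ) → Σℚ {suc n} (f ∘ toℕ) ≡ Σℚ {n} (f ∘ toℕ) ℚ.+ f n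
Σℚ-last zero    f = trans (ℚₚ.+-identityʳ (f 0)) (sym (ℚₚ.+-identityˡ (f 0)))
Σℚ-last (suc n) f = trans (cong (f 0 ℚ.+_) (Σℚ-last n (f ∘ suc)))
  (sym (ℚₚ.+-assoc (f 0) (Σℚ {n} (f ∘ suc ∘ toℕ)) (f (suc n))))

eval-drop : ∀ n f x → f n ≡ 0ℚ → eval (suc n) f x ≡ eval n f x
eval-drop n f x fn≡0 = begin
  eval (suc n) f x                  ≡⟨ Σℚ-last n (λ i → f i ℚ.* (x ^ℚ i)) ⟩
  eval n f x ℚ.+ f n ℚ.* (x ^ℚ n)   ≡⟨ cong (λ w → eval n f x ℚ.+ w ℚ.* (x ^ℚ n)) fn≡0 ⟩
  eval n f x ℚ.+ 0ℚ ℚ.* (x ^ℚ n)    ≡⟨ cong (eval n f x ℚ.+_) (ℚₚ.*-zeroˡ (x ^ℚ n)) ⟩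
  eval n f x ℚ.+ 0ℚ                 ≡⟨ ℚₚ.+-identityʳ (eval n f x) ⟩
  eval n f x                        ∎
  where open ≡-Reasoning

-- Restores the constant term 1 of the Ehrhart polynomial, where `coef` has the default 0. This 1
-- later fixes the sign of h₃ and h₁.
coeffs : ∀ {n} → (Fin n → ℚ) → ℕ → ℚ
coeffs c zero    = 1ℚ
coeffs c (suc i) = coef c (suc i)

coef-suc-toℕ : ∀ {n} (c : Fin n → ℚ) j → coef c (suc (toℕ j)) ≡ c j
coef-suc-toℕ {suc n} c zero    = refl
coef-suc-toℕ {suc n} c (suc j) = coef-suc-toℕ (c ∘ suc) j

coef-beyond : ∀ {n} (c : Fin n → ℚ) i → coef c (suc (n + i)) ≡ 0ℚ
coef-beyond {zero}  c i = refl
coef-beyond {suc n} c i = coef-beyond (c ∘ suc) i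

coef-within : ∀ {n} (c : Fin n → ℚ) (P : ℚ → Set) → (∀ j → P (c j)) → ∀ i → 1 ≤ i → i ≤ n → P (coef c i)
coef-within {suc n} c P Pc (suc zero)    _ _           = Pc zero
coef-within {suc n} c P Pc (suc (suc i)) _ (ℕ.s≤s i≤n) = coef-within (c ∘ suc) P (Pc ∘ suc) (suc i) (ℕ.s≤s ℕ.z≤n) i≤n

coef-all : ∀ {n} (c : Fin n → ℚ) (P : ℚ → Set) → P 0ℚ → (∀ j → P (c j)) → ∀ i → P (coef c i)
coef-all {zero}  c P P0 Pc i             = P0
coef-all {suc n} c P P0 Pc zero          = P0
coef-all {suc n} c P P0 Pc (suc zero)    = Pc zero
coef-all {suc n} c P P0 Pc (suc (suc i)) = coef-all (c ∘ suc) P P0 (Pc ∘ suc) (suc i)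

truncate : ∀ n → (ℕ → ℚ) → Fin n → ℚ
truncate n f j = f (suc (toℕ j))

coef-truncate : ∀ n f i → 1 ≤ i → i ≤ n → coef (truncate n f) i ≡ f i
coef-truncate (suc n) f (suc zero)    _ _           = refl
coef-truncate (suc n) f (suc (suc i)) _ (ℕ.s≤s i≤n) = coef-truncate n (f ∘ suc) (suc i) (ℕ.s≤s ℕ.z≤n) i≤n

EhrPoly-truncate : ∀ n f t → f 0 ≡ 1ℚ → EhrPoly (truncate n f) t ≡ eval (suc n) f (ℕtoℚ t)
EhrPoly-truncate n f t f0≡1 = cong (ℚ._+ Σℚ (λ j → truncate n f j ℚ.* (ℕtoℚ t ^ℚ suc (toℕ j))))
  (sym (trans (ℚₚ.*-identityʳ (f 0)) f0≡1))

EhrPoly-coeffs : ∀ {n} (c : Fin n → ℚ) t → EhrPoly c t ≡ eval (suc n) (coeffs c) (ℕtoℚ t)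
EhrPoly-coeffs c t = cong (1ℚ ℚ.+_)
  (Σℚ-cong (λ j → cong (ℚ._* (ℕtoℚ t ^ℚ suc (toℕ j))) (sym (coef-suc-toℕ c j))))

-- The coefficients of (1 + r₁ x + r₂ x² + r₃ x³) f.
mulCubic : (Fin 3 → ℚ) → (ℕ → ℚ) → ℕ → ℚ
mulCubic r f i = f i ℚ.+ (r zero ℚ.* shift f i ℚ.+
  (r (suc zero) ℚ.* shift (shift f) i ℚ.+ r (suc (suc zero)) ℚ.* shift (shift (shift f)) i))

-- All four summands are evaluated over the common length `4 + n`. Each shift uses up one term, and
-- the surplus terms vanish because `coeffs c` is zero beyond `n`.
EhrPoly-mulCubic : ∀ {n} r (c : Fin n → ℚ) t →
  EhrPoly (truncate (3 + n) (mulCubic r (coeffs c))) t ≡ EhrPoly r t ℚ.* EhrPoly c t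
EhrPoly-mulCubic {n} r c t = begin
  EhrPoly (truncate (3 + n) (mulCubic r f)) t
    ≡⟨ EhrPoly-truncate (3 + n) (mulCubic r f) t constant ⟩
  eval (4 + n) (mulCubic r f) T
    ≡⟨ eval-+ (4 + n) f (λ i → g₁ i ℚ.+ (g₂ i ℚ.+ g₃ i)) T ⟩
  eval (4 + n) f T ℚ.+ eval (4 + n) (λ i → g₁ i ℚ.+ (g₂ i ℚ.+ g₃ i)) T
    ≡⟨ cong (eval (4 + n) f T ℚ.+_) (trans (eval-+ (4 + n) g₁ (λ i → g₂ i ℚ.+ g₃ i) T)
         (cong₂ ℚ._+_ (eval-* (4 + n) r₁ (shift f) T)
           (trans (eval-+ (4 + n) g₂ g₃ T)
             (cong₂ ℚ._+_ (eval-* (4 + n) r₂ (shift (shift f)) T) (eval-* (4 + n) r₃ (shift (shift (shift f))) T))))) ⟩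
  eval (4 + n) f T ℚ.+ (r₁ ℚ.* eval (4 + n) (shift f) T ℚ.+
    (r₂ ℚ.* eval (4 + n) (shift (shift f)) T ℚ.+ r₃ ℚ.* eval (4 + n) (shift (shift (shift f))) T))
    ≡⟨ cong₂ ℚ._+_ top (cong₂ ℚ._+_ (cong (r₁ ℚ.*_) shift₁)
         (cong₂ ℚ._+_ (cong (r₂ ℚ.*_) shift₂) (cong (r₃ ℚ.*_) shift₃))) ⟩
  V ℚ.+ (r₁ ℚ.* (T ℚ.* V) ℚ.+ (r₂ ℚ.* (T ℚ.* (T ℚ.* V)) ℚ.+ r₃ ℚ.* (T ℚ.* (T ℚ.* (T ℚ.* V)))))
    ≡⟨ solve 5 (λ r₁ r₂ r₃ T V → V :+ (r₁ :* (T :* V) :+ (r₂ :* (T :* (T :* V)) :+ r₃ :* (T :* (T :* (T :* V))))) :=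
           (con 1ℚ :+ (r₁ :* (T :* con 1ℚ) :+ (r₂ :* (T :* (T :* con 1ℚ)) :+ (r₃ :* (T :* (T :* (T :* con 1ℚ))) :+ con 0ℚ)))) :* V)
         refl r₁ r₂ r₃ T V ⟩
  EhrPoly r t ℚ.* V
    ≡⟨ cong (EhrPoly r t ℚ.*_) (EhrPoly-coeffs c t) ⟨
  EhrPoly r t ℚ.* EhrPoly c t ∎
  where
  open ≡-Reasoning
  open +-*-Solver
  f = coeffs c
  T = ℕtoℚ t
  V = eval (suc n) f T
  r₁ = r zero
  r₂ = r (suc zero)
  r₃ = r (suc (suc zero))
  g₁ g₂ g₃ : ℕ → ℚ
  g₁ i = r₁ ℚ.* shift f i
  g₂ i = r₂ ℚ.* shift (shift f) i
  g₃ i = r₃ ℚ.* shift (shift (shift f)) i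
  constant : mulCubic r f 0 ≡ 1ℚ
  constant = solve 3 (λ r₁ r₂ r₃ → con 1ℚ :+ (r₁ :* con 0ℚ :+ (r₂ :* con 0ℚ :+ r₃ :* con 0ℚ)) := con 1ℚ) refl r₁ r₂ r₃
  beyond : ∀ i → f (i + suc n) ≡ 0ℚ
  beyond i = trans (cong f (trans (ℕₚ.+-suc i n) (cong suc (ℕₚ.+-comm i n)))) (coef-beyond c i)
  drop₁ : eval (2 + n) f T ≡ V
  drop₁ = eval-drop (suc n) f T (beyond 0)
  drop₂ : eval (3 + n) f T ≡ V
  drop₂ = trans (eval-drop (2 + n) f T (beyond 1)) drop₁
  top : eval (4 + n) f T ≡ V
  top = trans (eval-drop (3 + n) f T (beyond 2)) drop₂
  shift₁ : eval (4 + n) (shift f) T ≡ T ℚ.* V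
  shift₁ = trans (eval-shift (3 + n) f T) (cong (T ℚ.*_) drop₂)
  shift₂ : eval (4 + n) (shift (shift f)) T ≡ T ℚ.* (T ℚ.* V)
  shift₂ = trans (eval-shift (3 + n) (shift f) T)
    (cong (T ℚ.*_) (trans (eval-shift (2 + n) f T) (cong (T ℚ.*_) drop₁)))
  shift₃ : eval (4 + n) (shift (shift (shift f))) T ≡ T ℚ.* (T ℚ.* (T ℚ.* V))
  shift₃ = trans (eval-shift (3 + n) (shift (shift f)) T)
    (cong (T ℚ.*_) (trans (eval-shift (2 + n) (shift f) T) (cong (T ℚ.*_) (eval-shift (1 + n) f T))))

HasEhrhart-⊗ : ∀ {M N n} (P : IntPolytope M) (Q : IntPolytope N) (r : Fin 3 → ℚ) (c : Fin n → ℚ) →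
  HasEhrhart P r → HasEhrhart Q c → HasEhrhart (P ⊗ Q) (truncate (3 + n) (mulCubic r (coeffs c)))
HasEhrhart-⊗ {n = n} P Q r c P-ehr Q-ehr t 1≤t = product (P-ehr t 1≤t) (Q-ehr t 1≤t)
  where
  open ≡-Reasoning
  h = truncate (3 + n) (mulCubic r (coeffs c))
  Points : ∀ {N} → IntPolytope N → ℚ → Set
  Points {N} P q = Σ (List (Point N)) λ L →
    Unique L × ((x : Point N) → (x ∈ L) ⇔ InDilate t P x) × (ℕtoℚ (length L) ≡ q)
  product : Points P (EhrPoly r t) → Points Q (EhrPoly c t) → Points (P ⊗ Q) (EhrPoly h t)
  product (L , L! , L⇔ , |L|≡) (K , K! , K⇔ , |K|≡) =
    cartesianProductWith Vec._++_ L K , proj₁ lists , proj₂ lists , (begin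
      ℕtoℚ (length (cartesianProductWith Vec._++_ L K)) ≡⟨ cong ℕtoℚ (length-cartesianProductWith Vec._++_ L K) ⟩
      ℕtoℚ (length L ℕ.* length K)                      ≡⟨ ℕtoℚ-* (length L) (length K) ⟩
      ℕtoℚ (length L) ℚ.* ℕtoℚ (length K)               ≡⟨ cong₂ ℚ._*_ |L|≡ |K|≡ ⟩
      EhrPoly r t ℚ.* EhrPoly c t                       ≡⟨ EhrPoly-mulCubic r c t ⟨
      EhrPoly h t                                       ∎)
    where lists = Enumerates-⊗ P Q 1≤t (L! , L⇔) (K! , K⇔)

-- Signs

sgn-pos : ∀ {q} → 0ℚ ℚ.< q → sgn q ≡ + 1
sgn-pos {q} 0<q with 0ℚ ℚₚ.<? q
... | yes _   = refl
... | no  0≮q = ⊥-elim (0≮q 0<q)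

sgn-neg : ∀ {q} → q ℚ.< 0ℚ → sgn q ≡ -[1+ 0 ]
sgn-neg {q} q<0 with 0ℚ ℚₚ.<? q
... | yes 0<q = ⊥-elim (ℚₚ.<-asym 0<q q<0)
... | no  _ with q ℚₚ.<? 0ℚ
...   | yes _   = refl
...   | no  q≮0 = ⊥-elim (q≮0 q<0)

sgn-− : ∀ {q} → q ≢ 0ℚ → sgn (ℚ.- q) ≡ - sgn q
sgn-− {q} q≢0 with ℚₚ.<-cmp q 0ℚ
... | tri< q<0 _ _ = trans (sgn-pos (ℚₚ.neg-antimono-< q<0)) (cong -_ (sym (sgn-neg q<0)))
... | tri≈ _ q≡0 _ = ⊥-elim (q≢0 q≡0)
... | tri> _ _ 0<q = trans (sgn-neg (ℚₚ.neg-antimono-< 0<q)) (cong -_ (sym (sgn-pos 0<q)))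

p≤∣p∣ : ∀ p → p ℚ.≤ ℚ.∣ p ∣
p≤∣p∣ p with ℚₚ.≤-total 0ℚ p
... | inj₁ 0≤p = ℚₚ.≤-reflexive (sym (ℚₚ.0≤p⇒∣p∣≡p 0≤p))
... | inj₂ p≤0 = ℚₚ.≤-trans p≤0 (ℚₚ.0≤∣p∣ p)

*-monoˡ-≤ : ∀ r {p q} → 0ℚ ℚ.≤ r → p ℚ.≤ q → r ℚ.* p ℚ.≤ r ℚ.* q
*-monoˡ-≤ r 0≤r = ℚₚ.*-monoˡ-≤-nonNeg r {{ℚ.nonNegative 0≤r}}

-- R a > K D a ≥ K ≥ |e|. Natural bounds `K` for |e| and `D` for 1/a reduce every later comparison
-- of magnitudes to one in ℕ.
dominant⁺ : ∀ R K D {a e} → 0ℚ ℚ.< a → 1ℚ ℚ.≤ ℕtoℚ D ℚ.* a → ℚ.∣ e ∣ ℚ.≤ ℕtoℚ K → K ℕ.* D ℕ.< R →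
  0ℚ ℚ.< ℕtoℚ R ℚ.* a ℚ.+ e
dominant⁺ R K D {a} {e} 0<a 1≤Da |e|≤K KD<R = begin-strict
  0ℚ                  ≡⟨ ℚₚ.+-inverseˡ e ⟨
  ℚ.- e ℚ.+ e         <⟨ ℚₚ.+-monoˡ-< e -e<Ra ⟩
  ℕtoℚ R ℚ.* a ℚ.+ e  ∎
  where
  open ℚₚ.≤-Reasoning
  -e<Ra : ℚ.- e ℚ.< ℕtoℚ R ℚ.* a
  -e<Ra = begin-strict
    ℚ.- e                        ≤⟨ p≤∣p∣ (ℚ.- e) ⟩
    ℚ.∣ ℚ.- e ∣                  ≡⟨ ℚₚ.∣-p∣≡∣p∣ e ⟩
    ℚ.∣ e ∣                      ≤⟨ |e|≤K ⟩
    ℕtoℚ K                       ≡⟨ ℚₚ.*-identityʳ (ℕtoℚ K) ⟨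
    ℕtoℚ K ℚ.* 1ℚ                ≤⟨ *-monoˡ-≤ (ℕtoℚ K) (0≤ℕtoℚ K) 1≤Da ⟩
    ℕtoℚ K ℚ.* (ℕtoℚ D ℚ.* a)    ≡⟨ ℚₚ.*-assoc (ℕtoℚ K) (ℕtoℚ D) a ⟨
    ℕtoℚ K ℚ.* ℕtoℚ D ℚ.* a      ≡⟨ cong (ℚ._* a) (ℕtoℚ-* K D) ⟨
    ℕtoℚ (K ℕ.* D) ℚ.* a         <⟨ ℚₚ.*-monoˡ-<-pos a {{ℚ.positive 0<a}} (ℕtoℚ-mono-< KD<R) ⟩
    ℕtoℚ R ℚ.* a                 ∎

sgn-dominant : ∀ R K D {a e} → 1ℚ ℚ.≤ ℕtoℚ D ℚ.* ℚ.∣ a ∣ → ℚ.∣ e ∣ ℚ.≤ ℕtoℚ K → K ℕ.* D ℕ.< R →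
  sgn (ℕtoℚ R ℚ.* a ℚ.+ e) ≡ sgn a
sgn-dominant R K D {a} {e} 1≤D|a| |e|≤K KD<R with ℚₚ.<-cmp a 0ℚ
... | tri> _ _ 0<a = trans
  (sgn-pos (dominant⁺ R K D 0<a (subst (λ w → 1ℚ ℚ.≤ ℕtoℚ D ℚ.* w) (ℚₚ.0≤p⇒∣p∣≡p (ℚₚ.<⇒≤ 0<a)) 1≤D|a|) |e|≤K KD<R))
  (sym (sgn-pos 0<a))
... | tri≈ _ a≡0 _ = ⊥-elim (ℚₚ.<-irrefl refl (ℚₚ.<-≤-trans 0<1 (subst (1ℚ ℚ.≤_) D|a|≡0 1≤D|a|)))
  where
  0<1 : 0ℚ ℚ.< 1ℚ
  0<1 = ℚₚ.positive⁻¹ 1ℚ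
  D|a|≡0 : ℕtoℚ D ℚ.* ℚ.∣ a ∣ ≡ 0ℚ
  D|a|≡0 = trans (cong (λ w → ℕtoℚ D ℚ.* ℚ.∣ w ∣) a≡0) (ℚₚ.*-zeroʳ (ℕtoℚ D))
... | tri< a<0 _ _ = trans (sgn-neg Ra+e<0) (sym (sgn-neg a<0))
  where
  open +-*-Solver
  0<-a : 0ℚ ℚ.< ℚ.- a
  0<-a = ℚₚ.neg-antimono-< a<0
  |a|≡-a : ℚ.∣ a ∣ ≡ ℚ.- a
  |a|≡-a = trans (sym (ℚₚ.∣-p∣≡∣p∣ a)) (ℚₚ.0≤p⇒∣p∣≡p (ℚₚ.<⇒≤ 0<-a))
  Ra+e<0 : ℕtoℚ R ℚ.* a ℚ.+ e ℚ.< 0ℚ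
  Ra+e<0 = subst (ℚ._< 0ℚ)
    (solve 3 (λ R a e → :- (R :* (:- a) :+ (:- e)) := R :* a :+ e) refl (ℕtoℚ R) a e)
    (ℚₚ.neg-antimono-< (dominant⁺ R K D 0<-a (subst (λ w → 1ℚ ℚ.≤ ℕtoℚ D ℚ.* w) |a|≡-a 1≤D|a|)
      (subst (ℚ._≤ ℕtoℚ K) (sym (ℚₚ.∣-p∣≡∣p∣ e)) |e|≤K) KD<R))

∣p+q∣≤ : ∀ {p q} m n → ℚ.∣ p ∣ ℚ.≤ ℕtoℚ m → ℚ.∣ q ∣ ℚ.≤ ℕtoℚ n → ℚ.∣ p ℚ.+ q ∣ ℚ.≤ ℕtoℚ (m + n)
∣p+q∣≤ {p} {q} m n |p|≤m |q|≤n = begin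
  ℚ.∣ p ℚ.+ q ∣           ≤⟨ ℚₚ.∣p+q∣≤∣p∣+∣q∣ p q ⟩
  ℚ.∣ p ∣ ℚ.+ ℚ.∣ q ∣     ≤⟨ ℚₚ.+-mono-≤ |p|≤m |q|≤n ⟩
  ℕtoℚ m ℚ.+ ℕtoℚ n       ≡⟨ ℕtoℚ-+ m n ⟨
  ℕtoℚ (m + n)            ∎
  where open ℚₚ.≤-Reasoning

∣n*q∣≤ : ∀ n {q} m → ℚ.∣ q ∣ ℚ.≤ ℕtoℚ m → ℚ.∣ ℕtoℚ n ℚ.* q ∣ ℚ.≤ ℕtoℚ (n ℕ.* m)
∣n*q∣≤ n {q} m |q|≤m = begin
  ℚ.∣ ℕtoℚ n ℚ.* q ∣         ≡⟨ ℚₚ.∣p*q∣≡∣p∣*∣q∣ (ℕtoℚ n) q ⟩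
  ℚ.∣ ℕtoℚ n ∣ ℚ.* ℚ.∣ q ∣   ≡⟨ cong (ℚ._* ℚ.∣ q ∣) (ℚₚ.0≤p⇒∣p∣≡p (0≤ℕtoℚ n)) ⟩
  ℕtoℚ n ℚ.* ℚ.∣ q ∣         ≤⟨ *-monoˡ-≤ (ℕtoℚ n) (0≤ℕtoℚ n) |q|≤m ⟩
  ℕtoℚ n ℚ.* ℕtoℚ m          ≡⟨ ℕtoℚ-* n m ⟨
  ℕtoℚ (n ℕ.* m)             ∎
  where open ℚₚ.≤-Reasoning

-- Natural bounds for nonzero rationals

p*↧p≡↥p : ∀ p → p ℚ.* ℕtoℚ (ℚ.↧ₙ p) ≡ ℤtoℚ (ℚ.↥ p)
p*↧p≡↥p p = clear p (ℚₚ.toℚᵘ-fromℚᵘ (ℚᵘ.mkℚᵘ (ℚ.↧ p) 0)) (ℚₚ.toℚᵘ-fromℚᵘ (ℚᵘ.mkℚᵘ (ℚ.↥ p) 0))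
  where
  open ℚᵘₚ.≃-Reasoning
  -- Matching on `p` exposes its numerator and denominator to `toℚᵘ`, while `q` and `r` stay
  -- abstract, so that the embedded integers enter only through their unnormalised values.
  clear : ∀ p {q r} → ℚ.toℚᵘ q ℚᵘ.≃ ℚᵘ.mkℚᵘ (ℚ.↧ p) 0 → ℚ.toℚᵘ r ℚᵘ.≃ ℚᵘ.mkℚᵘ (ℚ.↥ p) 0 → p ℚ.* q ≡ r
  clear p@record{} {q} {r} q≃ r≃ = ℚₚ.toℚᵘ-injective (begin
    ℚ.toℚᵘ (p ℚ.* q)                  ≈⟨ ℚₚ.toℚᵘ-homo-* p q ⟩
    ℚ.toℚᵘ p ℚᵘ.* ℚ.toℚᵘ q            ≈⟨ ℚᵘₚ.*-cong (ℚᵘₚ.≃-refl {ℚ.toℚᵘ p}) q≃ ⟩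
    ℚ.toℚᵘ p ℚᵘ.* ℚᵘ.mkℚᵘ (ℚ.↧ p) 0   ≈⟨ ℚᵘ.*≡* (trans (ℤₚ.*-identityʳ (ℚ.↥ p ℤ.* ℚ.↧ p))
                                           (cong (λ d → ℚ.↥ p ℤ.* + d) (sym (ℕₚ.*-identityʳ (ℚ.↧ₙ p))))) ⟩
    ℚᵘ.mkℚᵘ (ℚ.↥ p) 0                 ≈⟨ r≃ ⟨
    ℚ.toℚᵘ r                          ∎)

-- |q| = n / d in lowest terms gives both |q| ≤ n and 1 ≤ d |q|.
∣q∣-fraction : ∀ q → ∃ λ n → ∃ λ d → 1 ≤ d × ℕtoℚ d ℚ.* ℚ.∣ q ∣ ≡ ℕtoℚ n
∣q∣-fraction q with integral⇒ℕ (ℚ.↥ p) (sym (p*↧p≡↥p p)) (0≤p*q (ℚₚ.0≤∣p∣ q) (0≤ℕtoℚ (ℚ.↧ₙ p)))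
  where p = ℚ.∣ q ∣
... | n , ↥p≡n = n , ℚ.↧ₙ p , ℕ.s≤s ℕ.z≤n ,
  trans (ℚₚ.*-comm (ℕtoℚ (ℚ.↧ₙ p)) p) (trans (p*↧p≡↥p p) (cong ℤtoℚ ↥p≡n))
  where p = ℚ.∣ q ∣

weaken-≤ : ∀ p {m n} → m ≤ n → p ℚ.≤ ℕtoℚ m → p ℚ.≤ ℕtoℚ n
weaken-≤ p {m} {n} m≤n p≤m = ℚₚ.≤-trans {p} {ℕtoℚ m} {ℕtoℚ n} p≤m (ℕtoℚ-mono-≤ {m} {n} m≤n)

weaken-1≤ : ∀ q {m n} → m ≤ n → 1ℚ ℚ.≤ ℕtoℚ m ℚ.* ℚ.∣ q ∣ → 1ℚ ℚ.≤ ℕtoℚ n ℚ.* ℚ.∣ q ∣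
weaken-1≤ q {m} {n} m≤n 1≤ = ℚₚ.≤-trans 1≤
  (ℚₚ.*-monoʳ-≤-nonNeg ℚ.∣ q ∣ {{ℚₚ.∣-∣-nonNeg q}} (ℕtoℚ-mono-≤ {m} {n} m≤n))

p≤q*p : ∀ p q → 0ℚ ℚ.≤ p → 1ℚ ℚ.≤ q → p ℚ.≤ q ℚ.* p
p≤q*p p q 0≤p 1≤q = subst (ℚ._≤ q ℚ.* p) (ℚₚ.*-identityˡ p)
  (ℚₚ.*-monoʳ-≤-nonNeg p {{ℚ.nonNegative 0≤p}} {1ℚ} {q} 1≤q)

∣q∣-upper : ∀ q → ∃ λ n → ℚ.∣ q ∣ ℚ.≤ ℕtoℚ n
∣q∣-upper q = let n , d , 1≤d , d|q|≡n = ∣q∣-fraction q in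
  n , subst (ℚ.∣ q ∣ ℚ.≤_) d|q|≡n (p≤q*p ℚ.∣ q ∣ (ℕtoℚ d) (ℚₚ.0≤∣p∣ q) (ℕtoℚ-mono-≤ {1} {d} 1≤d))

∣q∣-lower : ∀ q → q ≢ 0ℚ → ∃ λ d → 1ℚ ℚ.≤ ℕtoℚ d ℚ.* ℚ.∣ q ∣
∣q∣-lower q q≢0 = let n , d , 1≤d , d|q|≡n = ∣q∣-fraction q in
  d , subst (1ℚ ℚ.≤_) (sym d|q|≡n) (ℕtoℚ-mono-≤ {1} {n} (ℕₚ.n≢0⇒n>0 λ n≡0 → q≢0 (ℚₚ.∣p∣≡0⇒p≡0 q
    (p*q≡0∧q≢0⇒p≡0 ℚ.∣ q ∣ (d≢0 d 1≤d) (trans (ℚₚ.*-comm ℚ.∣ q ∣ (ℕtoℚ d)) (trans d|q|≡n (cong ℕtoℚ n≡0)))))))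
  where
  d≢0 : ∀ d → 1 ≤ d → ℕtoℚ d ≢ 0ℚ
  d≢0 d 1≤d d≡0 = ℕₚ.<⇒≢ 1≤d (sym (ℤₚ.+-injective (ℤtoℚ-injective {+ d} {+ 0} d≡0)))

family-upper : ∀ {n} (c : Fin n → ℚ) → ∃ λ C → ∀ i → ℚ.∣ c i ∣ ℚ.≤ ℕtoℚ C
family-upper {zero}  c = 0 , λ ()
family-upper {suc n} c = m + C , bound
  where
  m = proj₁ (∣q∣-upper (c zero))
  C = proj₁ (family-upper (c ∘ suc))
  bound : ∀ i → ℚ.∣ c i ∣ ℚ.≤ ℕtoℚ (m + C)
  bound zero    = weaken-≤ ℚ.∣ c zero ∣ {m} {m + C} (ℕₚ.m≤m+n m C) (proj₂ (∣q∣-upper (c zero)))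
  bound (suc i) = weaken-≤ ℚ.∣ c (suc i) ∣ {C} {m + C} (ℕₚ.m≤n+m C m) (proj₂ (family-upper (c ∘ suc)) i)

family-lower : ∀ {n} (c : Fin n → ℚ) → (∀ i → c i ≢ 0ℚ) → ∃ λ D → ∀ i → 1ℚ ℚ.≤ ℕtoℚ D ℚ.* ℚ.∣ c i ∣
family-lower {zero}  c c≢0 = 0 , λ ()
family-lower {suc n} c c≢0 = m + D , bound
  where
  m = proj₁ (∣q∣-lower (c zero) (c≢0 zero))
  D = proj₁ (family-lower (c ∘ suc) (c≢0 ∘ suc))
  bound : ∀ i → 1ℚ ℚ.≤ ℕtoℚ (m + D) ℚ.* ℚ.∣ c i ∣
  bound zero    = weaken-1≤ (c zero) {m} {m + D} (ℕₚ.m≤m+n m D) (proj₂ (∣q∣-lower (c zero) (c≢0 zero)))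
  bound (suc i) = weaken-1≤ (c (suc i)) {D} {m + D} (ℕₚ.m≤n+m D m) (proj₂ (family-lower (c ∘ suc) (c≢0 ∘ suc)) i)

module _ {d} (c : Fin d → ℚ) (c≢0 : ∀ i → c i ≢ 0ℚ) where

  -- The successor makes the bound at least 1, so that it also covers the constant coefficient; the
  -- same holds for `lowerBound`.
  upperBound : ℕ
  upperBound = suc (proj₁ (family-upper c))

  lowerBound : ℕ
  lowerBound = suc (proj₁ (family-lower c c≢0))

  -- Stated at every index, because the error terms in the top coefficients of the product reach
  -- beyond degree `d`, where `coef` takes its default 0.
  ∣coeffs∣≤ : ∀ i → ℚ.∣ coeffs c i ∣ ℚ.≤ ℕtoℚ upperBound
  ∣coeffs∣≤ zero    = ℕtoℚ-mono-≤ {1} {upperBound} (ℕ.s≤s ℕ.z≤n)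
  ∣coeffs∣≤ (suc i) = coef-all c (λ q → ℚ.∣ q ∣ ℚ.≤ ℕtoℚ upperBound) (0≤ℕtoℚ upperBound)
    (λ j → weaken-≤ ℚ.∣ c j ∣ (ℕₚ.n≤1+n (proj₁ (family-upper c))) (proj₂ (family-upper c) j)) (suc i)

  1≤∣coeffs∣ : ∀ i → i ≤ d → 1ℚ ℚ.≤ ℕtoℚ lowerBound ℚ.* ℚ.∣ coeffs c i ∣
  1≤∣coeffs∣ zero    _   = weaken-1≤ 1ℚ {1} {lowerBound} (ℕ.s≤s ℕ.z≤n) (ℚₚ.≤-refl {1ℚ})
  1≤∣coeffs∣ (suc i) i≤d = coef-within c (λ q → 1ℚ ℚ.≤ ℕtoℚ lowerBound ℚ.* ℚ.∣ q ∣)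
    (λ j → weaken-1≤ (c j) (ℕₚ.n≤1+n (proj₁ (family-lower c c≢0))) (proj₂ (family-lower c c≢0) j)) (suc i) (ℕ.s≤s ℕ.z≤n) i≤d

  coeffs≢0 : ∀ i → 1 ≤ i → i ≤ d → coeffs c i ≢ 0ℚ
  coeffs≢0 (suc i) = coef-within c (_≢ 0ℚ) c≢0 (suc i)

-- For C ≥ |cᵢ| and 1/D ≤ |cᵢ|, these choices of l and s make l² small against l s / (C D), and l s small
-- against l³ (2 + s) / (C D).
module Scale (C D : ℕ) where

  l s : ℕ
  l = suc (C ℕ.* D)
  s = suc ((C + l ℕ.* l) ℕ.* D)

  linear-dominates : C ℕ.* D ℕ.< l ℕ.* s
  linear-dominates = ℕₚ.≤-trans (ℕₚ.≤-reflexive (sym (ℕₚ.*-identityʳ l))) (ℕₚ.*-monoʳ-≤ l (ℕ.s≤s ℕ.z≤n))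

  linear-dominates-quadratic : (C + l ℕ.* l) ℕ.* D ℕ.< l ℕ.* s
  linear-dominates-quadratic = ℕₚ.m≤m+n s ((C ℕ.* D) ℕ.* s)

  cubic-dominates : (C + (l ℕ.* s ℕ.* C + l ℕ.* l ℕ.* C)) ℕ.* D ℕ.< l ℕ.* l ℕ.* l ℕ.* (2 + s)
  cubic-dominates = ℕₚ.≤-trans (ℕₚ.m≤m+n _ (excess (C ℕ.* D) s)) (ℕₚ.≤-reflexive (identity C D s))
    where
    -- With E = C D and l = E + 1, this is l³ (2 + s) - E (1 + l s + l²) - 1 expanded in E and s.
    -- All its coefficients are positive, so the inequality holds whatever `s` is.
    excess : ℕ → ℕ → ℕ
    excess E s = 1 + 4 ℕ.* E + 4 ℕ.* E ℕ.* E + E ℕ.* E ℕ.* E + s ℕ.* (1 + 2 ℕ.* E + 2 ℕ.* E ℕ.* E + E ℕ.* E ℕ.* E)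
    identity : ∀ C D s → let E = C ℕ.* D ; l = suc E in
      suc ((C + (l ℕ.* s ℕ.* C + l ℕ.* l ℕ.* C)) ℕ.* D)
        + (1 + 4 ℕ.* E + 4 ℕ.* E ℕ.* E + E ℕ.* E ℕ.* E + s ℕ.* (1 + 2 ℕ.* E + 2 ℕ.* E ℕ.* E + E ℕ.* E ℕ.* E))
        ≡ l ℕ.* l ℕ.* l ℕ.* (2 + s)
    identity = solve-∀

∣-n*q∣≤ : ∀ n {q} m → ℚ.∣ q ∣ ℚ.≤ ℕtoℚ m → ℚ.∣ ℚ.- ℕtoℚ n ℚ.* q ∣ ℚ.≤ ℕtoℚ (n ℕ.* m)
∣-n*q∣≤ n {q} m |q|≤m = subst (ℚ._≤ ℕtoℚ (n ℕ.* m))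
  (trans (sym (ℚₚ.∣-p∣≡∣p∣ (ℕtoℚ n ℚ.* q))) (cong ℚ.∣_∣ (ℚₚ.neg-distribˡ-* (ℕtoℚ n) q)))
  (∣n*q∣≤ n m |q|≤m)

-- Signs of the coefficients of the product

module _ {d} (c : Fin d → ℚ) (c≢0 : ∀ i → c i ≢ 0ℚ) where

  private
    C D : ℕ
    C = upperBound c c≢0
    D = lowerBound c c≢0

  open Scale C D public using () renaming (l to dilation; s to height)

  private
    l s a₁ a₂ a₃ : ℕ
    l = dilation
    s = height
    a₁ = l ℕ.* s
    a₂ = l ℕ.* l
    a₃ = l ℕ.* l ℕ.* l ℕ.* (2 + s)
    f g : ℕ → ℚ
    f = coeffs c
    g = mulCubic (reeveCoeff l s) f
    open +-*-Solver

  sgn-upper : ∀ k → k ≤ d → sgn (g (3 + k)) ≡ sgn (f k)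
  sgn-upper k k≤d = trans
    (cong sgn (solve 4 (λ x y z w → x :+ (y :+ (z :+ w)) := w :+ (x :+ (y :+ z))) refl
      (f (3 + k)) (ℚ.- ℕtoℚ a₁ ℚ.* f (2 + k)) (ℕtoℚ a₂ ℚ.* f (1 + k)) (ℕtoℚ a₃ ℚ.* f k)))
    (sgn-dominant a₃ (C + (a₁ ℕ.* C + a₂ ℕ.* C)) D (1≤∣coeffs∣ c c≢0 k k≤d)
      (∣p+q∣≤ C (a₁ ℕ.* C + a₂ ℕ.* C) (∣coeffs∣≤ c c≢0 (3 + k))
        (∣p+q∣≤ (a₁ ℕ.* C) (a₂ ℕ.* C) (∣-n*q∣≤ a₁ C (∣coeffs∣≤ c c≢0 (2 + k))) (∣n*q∣≤ a₂ C (∣coeffs∣≤ c c≢0 (1 + k)))))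
      (Scale.cubic-dominates C D))

  -- The error beside the dominant -l s c₁ is c₂ + l², the l² being the quadratic coefficient times
  -- the constant term 1; it is the reason why `s` has to exceed l² D.
  sgn-2 : 1 ≤ d → sgn (g 2) ≡ - sgn (f 1)
  sgn-2 1≤d = trans
    (cong sgn (solve 5 (λ x y a₁ a₂ a₃ → x :+ ((:- a₁) :* y :+ (a₂ :* con 1ℚ :+ a₃ :* con 0ℚ)) := a₁ :* (:- y) :+ (x :+ a₂)) refl
      (f 2) (f 1) (ℕtoℚ a₁) (ℕtoℚ a₂) (ℕtoℚ a₃)))
    (trans
      (sgn-dominant a₁ (C + a₂) D
        (subst (λ w → 1ℚ ℚ.≤ ℕtoℚ D ℚ.* w) (sym (ℚₚ.∣-p∣≡∣p∣ (f 1))) (1≤∣coeffs∣ c c≢0 1 1≤d))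
        (∣p+q∣≤ C a₂ (∣coeffs∣≤ c c≢0 2) (ℚₚ.≤-reflexive (ℚₚ.0≤p⇒∣p∣≡p (0≤ℕtoℚ a₂))))
        (Scale.linear-dominates-quadratic C D))
      (sgn-− (coeffs≢0 c c≢0 1 ℕₚ.≤-refl 1≤d)))

  sgn-1 : sgn (g 1) ≡ -[1+ 0 ]
  sgn-1 = trans
    (cong sgn (solve 4 (λ x a₁ a₂ a₃ → x :+ ((:- a₁) :* con 1ℚ :+ (a₂ :* con 0ℚ :+ a₃ :* con 0ℚ)) := a₁ :* con (ℚ.- 1ℚ) :+ x) refl
      (f 1) (ℕtoℚ a₁) (ℕtoℚ a₂) (ℕtoℚ a₃)))
    -- The dominant factor is -1, whose absolute value is that of `coeffs c 0`; so the lower bound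
    -- at index 0 applies.
    (sgn-dominant a₁ C D {ℚ.- 1ℚ} (1≤∣coeffs∣ c c≢0 0 ℕ.z≤n) (∣coeffs∣≤ c c≢0 1) (Scale.linear-dominates C D))

-- The tetrahedron is the first factor because it fills its ambient space: forgetting its three
-- coordinates costs exactly its dimension, whereas the ambient space of `P` may be larger than `d`.
HasDim-reeve-⊗ : ∀ l m {N d} .{{_ : ℕ.NonZero l}} .{{_ : ℕ.NonZero m}} (P : IntPolytope N) →
  HasDim P d → HasDim (reeve l m ⊗ P) (3 + d)
HasDim-reeve-⊗ l m P ((f , f-indep) , dep) =
  (cross (reeve l m) P id f , AffIndep-⊗ (reeve l m) P id f (reeve-AffIndep l m) f-indep) ,
  ¬AffIndep-⊗ (reeve l m) P dep

theorem6p5 : (d N : ℕ) → 3 ≤ d → (P : IntPolytope N) → HasDim P d →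
    (c : Fin d → ℚ) → HasEhrhart P c → ((i : Fin d) → c i ≢ 0ℚ) →
    Σ ℕ λ M → Σ (IntPolytope M) λ Q → Σ (Fin (d + 3) → ℚ) λ h →
    HasDim Q (d + 3) × HasEhrhart Q h ×
    ((i : ℕ) → 4 ≤ i → i ≤ d + 1 → sgn (coef h i) ≡ sgn (coef c (i ∸ 3))) ×
    (sgn (coef h 3) ≡ + 1) ×
    (sgn (coef h 2) ≡ - sgn (coef c 1)) ×
    (sgn (coef h 1) ≡ -[1+ 0 ])
theorem6p5 d N 3≤d P P-dim c P-ehr c≢0 =
  3 + N , reeve l m ⊗ P , truncate (d + 3) g ,
  subst (HasDim (reeve l m ⊗ P)) (ℕₚ.+-comm 3 d) (HasDim-reeve-⊗ l m P P-dim) ,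
  subst (λ n → HasEhrhart (reeve l m ⊗ P) (truncate n g)) (ℕₚ.+-comm 3 d)
    (HasEhrhart-⊗ (reeve l m) P (reeveCoeff l s) c (HasEhrhart-reeve l s) P-ehr) ,
  higher ,
  -- At k = 0 the dominant term carries the constant coefficient 1, whose sign computes to `+ 1`.
  trans (cong sgn (coef-g 3 (ℕ.s≤s ℕ.z≤n) (ℕₚ.m≤n+m 3 d))) (sgn-upper c c≢0 0 ℕ.z≤n) ,
  trans (cong sgn (coef-g 2 (ℕ.s≤s ℕ.z≤n) (ℕₚ.m≤n⇒m≤o+n d (ℕ.s≤s (ℕ.s≤s ℕ.z≤n))))) (sgn-2 c c≢0 (ℕₚ.≤-trans (ℕ.s≤s ℕ.z≤n) 3≤d)) ,
  trans (cong sgn (coef-g 1 (ℕ.s≤s ℕ.z≤n) (ℕₚ.m≤n⇒m≤o+n d (ℕ.s≤s ℕ.z≤n)))) (sgn-1 c c≢0)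
  where
  l s m : ℕ
  l = dilation c c≢0
  s = height c c≢0
  m = suc (6 ℕ.* s + 11)
  g : ℕ → ℚ
  g = mulCubic (reeveCoeff l s) (coeffs c)
  coef-g : ∀ i → 1 ≤ i → i ≤ d + 3 → coef (truncate (d + 3) g) i ≡ g i
  coef-g = coef-truncate (d + 3) g
  higher : ∀ i → 4 ≤ i → i ≤ d + 1 → sgn (coef (truncate (d + 3) g) i) ≡ sgn (coef c (i ∸ 3))
  higher (suc (suc (suc (suc i)))) (ℕ.s≤s (ℕ.s≤s (ℕ.s≤s (ℕ.s≤s _)))) i≤d+1 = trans
    (cong sgn (coef-g (4 + i) (ℕ.s≤s ℕ.z≤n) (ℕₚ.≤-trans i≤d+1 (ℕₚ.+-monoʳ-≤ d (ℕ.s≤s ℕ.z≤n)))))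
    (sgn-upper c c≢0 (suc i) (ℕₚ.≤-trans (ℕₚ.m≤n+m (suc i) 2) (ℕ.s≤s⁻¹ (subst (4 + i ≤_) (ℕₚ.+-comm d 1) i≤d+1))))
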